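{- Let $n\ge 3$, let $k$ be a field, let $M\supset k$ be an infinite field, and let $\mathbf a,\mathbf b\in M^n$ be such that $f_n(\mathbf a;X)$ and $f_n(\mathbf b;X)$ both have no multiple root. Fix $j$ with $0\le j\le n-1$ and assume that $F_j(\mathbf a,\mathbf b;X)\in M[X]$ has no multiple root. Assume that the Galois groups $G_{\mathbf a}=\mathrm{Gal}(\mathrm{Spl}_M f_n(\mathbf a;X)/M)$ and $G_{\mathbf b}=\mathrm{Gal}(\mathrm{Spl}_M f_n(\mathbf b;X)/M)$ are both isomorphic to a transitive subgroup $G$ of the symmetric group $\mathfrak S_n$, and that all subgroups of $G$ of index $n$ are conjugate in $G$. Then $F_j(\mathbf a,\mathbf b;X)$ has a root in $M$ if and only if the splitting fields $\mathrm{Spl}_M f_n(\mathbf a;X)$ and $\mathrm{Spl}_M f_n(\mathbf b;X)$ (in a fixed algebraic closure of $M$) coincide.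
   Context: For $\mathbf a=(a_1,\ldots,a_n)\in M^n$ put $f_n(\mathbf a;X)=X^n-a_1X^{n-1}+a_2X^{n-2}-\cdots+(-1)^na_n$. Let $\alpha_1,\ldots,\alpha_n$ and $\beta_1,\ldots,\beta_n$ be the roots of $f_n(\mathbf a;X)$ and $f_n(\mathbf b;X)$ in a fixed algebraic closure of $M$, in a fixed order. For $\tau\in\mathfrak S_n$ let $(c_0^{\tau},\ldots,c_{n-1}^{\tau})$ be the unique solution of the Vandermonde system $\beta_{\tau(i)}=c_0^{\tau}+c_1^{\tau}\alpha_i+\cdots+c_{n-1}^{\tau}\alpha_i^{n-1}$ ($i=1,\ldots,n$). Define $F_j(\mathbf a,\mathbf b;X)=\prod_{\tau\in\mathfrak S_n}(X-c_j^{\tau})\in M[X]$. $\mathrm{Spl}_M f$ denotes the splitting field of $f$ over $M$.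
   Formalization: The isomorphisms with G are taken as abstract group isomorphisms, and it is assumed in addition that the Galois groups of f_n(a;X) and f_n(b;X) act transitively on the roots; without this the claim fails, e.g. for n = 4 and G = V_4 over the rationals with f_n(a;X) reducible. -}

module Defs where

open import Algebra.Apartness.Bundles using (HeytingCommutativeRing; HeytingField)
open import Algebra.Bundles using (CommutativeRing; Group)
open import Algebra.Bundles.Raw using (RawGroup; RawRing)
import Algebra.Definitions.RawSemiring as RawSemiringDefs
import Algebra.Morphism.Construct.Composition as Compose
import Algebra.Morphism.Construct.Identity as Identity
import Algebra.Morphism.GroupMonomorphism as GroupMono
import Algebra.Morphism.RingMonomorphism as RingMono
open import Algebra.Morphism.Structures using (module GroupMorphisms; module RingMorphisms)
import Algebra.Properties.Group as GroupProperties
open import Data.Fin.Base using (Fin; toℕ)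
open import Data.Fin.Permutation as Perm using (Permutation′; _∘ₚ_; _⟨$⟩ʳ_)
open import Data.List.Base using (List; []; _∷_; allFin; concatMap; foldr; map)
open import Data.List.Relation.Unary.Enumerates.Setoid using (IsEnumeration)
open import Data.Nat.Base using (ℕ; zero; suc; _∸_)
open import Data.Product.Base using (Σ; ∃; ∃-syntax; _×_; _,_; proj₁; proj₂)
open import Data.Vec.Functional using (Vector)
open import Function.Base using (id; _∘_; _∘₂_)
open import Function.Bundles using (Bijection; _⇔_)
open import Level using (Level; _⊔_)
open import Relation.Binary.Bundles using (Setoid)
open import Relation.Binary.PropositionalEquality as ≡ using (_≡_)
open import Relation.Nullary.Negation using (¬_)
open import Relation.Unary using (Pred)

private
  variable
    a ℓ c c₁ c₂ ℓ₁ ℓ₂ ℓ₃ ℓ₄ h h₁ h₂ : Level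

-- A Heyting field has a tight apartness. Given excluded middle, x # y is
-- equivalent to ¬ x ≈ y, so that Heyting fields are the usual fields:
-- 1# # 0# always holds, and x # 0# means that x is invertible.
fieldRing : HeytingField c ℓ₁ ℓ₂ → CommutativeRing c ℓ₁
fieldRing F = HeytingCommutativeRing.commutativeRing (HeytingField.heytingCommutativeRing F)

rawField : HeytingField c ℓ₁ ℓ₂ → RawRing c ℓ₁
rawField F = CommutativeRing.rawRing (fieldRing F)

Infinite : Setoid c ℓ → Set (c ⊔ ℓ)
Infinite S = ¬ (∃[ xs ] IsEnumeration S xs)

-- A homomorphism of fields is injective, so an embedding of fields is
-- a ring monomorphism.
module _ (K : HeytingField c₁ ℓ₁ ℓ₂) (L : HeytingField c₂ ℓ₃ ℓ₄) where

  private
    module K = HeytingField K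
    module L = HeytingField L

  IsFieldEmbedding : (K.Carrier → L.Carrier) → Set (c₁ ⊔ ℓ₁ ⊔ ℓ₃)
  IsFieldEmbedding = RingMorphisms.IsRingMonomorphism (rawField K) (rawField L)

-- The list a₀ ∷ a₁ ∷ … ∷ a_d ∷ [] stands for a₀ + a₁X + ⋯ + a_d X^d.
-- Trailing zeros are allowed; polynomials are compared coefficientwise.
module Polynomial (R : RawRing c ℓ) where

  open RawRing R

  Poly : Set c
  Poly = List Carrier

  coeff : Poly → ℕ → Carrier
  coeff []      _       = 0#
  coeff (a ∷ p) zero    = a
  coeff (a ∷ p) (suc i) = coeff p i

  infix  4 _≈ₚ_
  infixl 6 _+ₚ_
  infixl 7 _*ₚ_

  _≈ₚ_ : Poly → Poly → Set ℓ
  p ≈ₚ q = ∀ i → coeff p i ≈ coeff q i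

  _+ₚ_ : Poly → Poly → Poly
  []      +ₚ q       = q
  (a ∷ p) +ₚ []      = a ∷ p
  (a ∷ p) +ₚ (b ∷ q) = (a + b) ∷ (p +ₚ q)

  _*ₚ_ : Poly → Poly → Poly
  []      *ₚ q = []
  (a ∷ p) *ₚ q = map (a *_) q +ₚ (0# ∷ p *ₚ q)

  eval : Poly → Carrier → Carrier
  eval []      x = 0#
  eval (a ∷ p) x = a + x * eval p x

  C : Carrier → Poly
  C a = a ∷ []

  X : Poly
  X = 0# ∷ 1# ∷ []

  X-_ : Carrier → Poly
  X- a = X +ₚ C (- a)

  polyRing : RawRing c ℓ
  polyRing = record
    { Carrier = Poly
    ; _≈_     = _≈ₚ_
    ; _+_     = _+ₚ_
    ; _*_     = _*ₚ_
    ; -_      = map -_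
    ; 0#      = []
    ; 1#      = C 1#
    }

  open RawSemiringDefs (RawRing.rawSemiring polyRing) public
    using () renaming (_^_ to _^ₚ_; sum to sumₚ; product to productₚ; _∣_ to _∣ₚ_)

  listProductₚ : List Poly → Poly
  listProductₚ = foldr _*ₚ_ (C 1#)

  IsRoot : Poly → Carrier → Set ℓ
  IsRoot p x = eval p x ≈ 0#

  -- This only considers the roots in R itself, so to say that a
  -- polynomial over M has no multiple root, it has to be base-changed
  -- to an algebraic closure of M.
  NoMultipleRoot : Poly → Set (c ⊔ ℓ)
  NoMultipleRoot p = ∀ x → ¬ ((X- x) ^ₚ 2 ∣ₚ p)

-- fₙ(a; X) = Xⁿ − a₁Xⁿ⁻¹ + ⋯ + (−1)ⁿaₙ, where aᵢ₊₁ is the value of a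
-- at the i-th element of Fin n.
module _ (R : RawRing c ℓ) where

  open RawRing R
  open RawSemiringDefs rawSemiring using (_^_)
  open Polynomial R

  genericPoly : ∀ {n} → Vector Carrier n → Poly
  genericPoly {n} a =
    X ^ₚ n +ₚ sumₚ (λ i → C ((- 1#) ^ suc (toℕ i) * a i) *ₚ X ^ₚ (n ∸ suc (toℕ i)))

-- Every permutation of Fin n occurs exactly once, up to pointwise
-- equality: it is determined by the image of 0 and by the permutation
-- it induces on the remaining elements.
allPermutations : ∀ n → List (Permutation′ n)
allPermutations zero    = Perm.id ∷ []
allPermutations (suc n) =
  concatMap (λ i → map (Perm.insert Fin.zero i) (allPermutations n)) (allFin (suc n))

module _ (R : RawRing c ℓ) where

  open RawRing R
  open RawSemiringDefs rawSemiring using (_^_; sum)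
  open Polynomial R

  SolvesVandermonde : ∀ {n} (α β : Vector Carrier n) →
                      (Permutation′ n → Vector Carrier n) → Set ℓ
  SolvesVandermonde α β cs =
    ∀ τ i → β (τ ⟨$⟩ʳ i) ≈ sum (λ l → cs τ l * α i ^ toℕ l)

  -- This polynomial lives over the field containing the c^τ; that its
  -- coefficients lie in M is a consequence of the symmetry in the roots.
  F-poly : ∀ {n} → (Permutation′ n → Vector Carrier n) → Fin n → Poly
  F-poly {n} cs j = listProductₚ (map (λ τ → X- (cs τ j)) (allPermutations n))

module _ (K : HeytingField c₁ ℓ₁ ℓ₂) (L : HeytingField c₂ ℓ₃ ℓ₄) where

  private
    module K  = HeytingField K
    module L  = HeytingField L
    module KX = Polynomial (rawField K)
    module LX = Polynomial (rawField L)

  record IsAlgebraicClosure (ι : K.Carrier → L.Carrier) : Set (c₁ ⊔ c₂ ⊔ ℓ₁ ⊔ ℓ₃) where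
    field
      isFieldEmbedding    : IsFieldEmbedding K L ι
      algebraic           : ∀ x → ∃[ p ] (¬ (p KX.≈ₚ []) × LX.IsRoot (map ι p) x)
      algebraicallyClosed : ∀ p → ¬ (∃[ a ] p LX.≈ₚ LX.C a) → ∃[ x ] LX.IsRoot p x

module _ (K : HeytingField c₁ ℓ₁ ℓ₂) (L : HeytingField c₂ ℓ₃ ℓ₄)
         (ι : HeytingField.Carrier K → HeytingField.Carrier L) where

  private
    module K = HeytingField K
    module L = HeytingField L
    open RingMorphisms (rawField L) (rawField L)

  -- The smallest subfield of L that contains ι(K) and S.
  data Adjoin (S : Pred L.Carrier h) : Pred L.Carrier (c₁ ⊔ c₂ ⊔ ℓ₃ ⊔ h) where
    base : ∀ a → Adjoin S (ι a)
    gen  : ∀ {x} → S x → Adjoin S x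
    resp : ∀ {x y} → x L.≈ y → Adjoin S x → Adjoin S y
    add  : ∀ {x y} → Adjoin S x → Adjoin S y → Adjoin S (x L.+ y)
    mul  : ∀ {x y} → Adjoin S x → Adjoin S y → Adjoin S (x L.* y)
    neg  : ∀ {x} → Adjoin S x → Adjoin S (L.- x)
    inv  : ∀ {x y} → x L.* y L.≈ L.1# → Adjoin S x → Adjoin S y

  record Automorphism : Set (c₁ ⊔ c₂ ⊔ ℓ₃) where
    field
      ⟦_⟧               : L.Carrier → L.Carrier
      isRingIsomorphism : IsRingIsomorphism ⟦_⟧
      fixesBase         : ∀ a → ⟦ ι a ⟧ L.≈ ι a

    open IsRingIsomorphism isRingIsomorphism public

    ⟦_⟧⁻¹ : L.Carrier → L.Carrier
    ⟦ y ⟧⁻¹ = proj₁ (surjective y)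

    inverseˡ : ∀ y → ⟦ ⟦ y ⟧⁻¹ ⟧ L.≈ y
    inverseˡ y = proj₂ (surjective y) L.refl

    inverseʳ : ∀ x → ⟦ ⟦ x ⟧ ⟧⁻¹ L.≈ x
    inverseʳ x = injective (inverseˡ ⟦ x ⟧)

  open Automorphism

  private
    idAut : Automorphism
    idAut = record
      { ⟦_⟧               = id
      ; isRingIsomorphism = Identity.isRingIsomorphism (rawField L) L.refl
      ; fixesBase         = λ _ → L.refl
      }

    infixr 9 _∘ₐ_
    _∘ₐ_ : Automorphism → Automorphism → Automorphism
    σ ∘ₐ ρ = record
      { ⟦_⟧               = ⟦ σ ⟧ ∘ ⟦ ρ ⟧
      ; isRingIsomorphism =
          Compose.isRingIsomorphism L.trans (isRingIsomorphism ρ) (isRingIsomorphism σ)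
      ; fixesBase         = λ a → L.trans (⟦⟧-cong σ (fixesBase ρ a)) (fixesBase σ a)
      }

    module Inverse (σ : Automorphism) where

      move : ∀ {x y} → ⟦ σ ⟧ x L.≈ y → ⟦ σ ⟧⁻¹ y L.≈ x
      move p = injective σ (L.trans (inverseˡ σ _) (L.sym p))

      cong⁻¹ : ∀ {x y} → x L.≈ y → ⟦ σ ⟧⁻¹ x L.≈ ⟦ σ ⟧⁻¹ y
      cong⁻¹ p = move (L.trans (inverseˡ σ _) (L.sym p))

      invAut : Automorphism
      invAut = record
        { ⟦_⟧ = ⟦ σ ⟧⁻¹
        ; isRingIsomorphism = record
          { isRingMonomorphism = record
            { isRingHomomorphism = record
              { isSemiringHomomorphism = record
                { isNearSemiringHomomorphism = record
                  { +-isMonoidHomomorphism = record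
                    { isMagmaHomomorphism = record
                      { isRelHomomorphism = record { cong = cong⁻¹ }
                      ; homo = λ x y → move (L.trans (+-homo σ _ _)
                                 (L.+-cong (inverseˡ σ x) (inverseˡ σ y)))
                      }
                    ; ε-homo = move (0#-homo σ)
                    }
                  ; *-homo = λ x y → move (L.trans (*-homo σ _ _)
                               (L.*-cong (inverseˡ σ x) (inverseˡ σ y)))
                  }
                ; 1#-homo = move (1#-homo σ)
                }
              ; -‿homo = λ x → move (L.trans (-‿homo σ _) (L.-‿cong (inverseˡ σ x)))
              }
            ; injective = λ {x} {y} p → L.trans (L.sym (inverseˡ σ x))
                (L.trans (⟦⟧-cong σ p) (inverseˡ σ y))
            }
          ; surjective = λ x → ⟦ σ ⟧ x , move ∘ L.sym
          }
        ; fixesBase = λ a → move (fixesBase σ a)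
        }

  Gal : Group (c₁ ⊔ c₂ ⊔ ℓ₃) (c₂ ⊔ ℓ₃)
  Gal = record
    { Carrier = Automorphism
    ; _≈_     = λ σ ρ → ∀ x → ⟦ σ ⟧ x L.≈ ⟦ ρ ⟧ x
    ; _∙_     = _∘ₐ_
    ; ε       = idAut
    ; _⁻¹     = Inverse.invAut
    ; isGroup = record
      { isMonoid = record
        { isSemigroup = record
          { isMagma = record
            { isEquivalence = record
              { refl  = λ _ → L.refl
              ; sym   = λ p x → L.sym (p x)
              ; trans = λ p q x → L.trans (p x) (q x)
              }
            ; ∙-cong = λ {σ} {σ′} {ρ} {ρ′} p q x →
                L.trans (⟦⟧-cong σ (q x)) (p (⟦ ρ′ ⟧ x))
            }
          ; assoc = λ _ _ _ _ → L.refl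
          }
        ; identity = (λ _ _ → L.refl) , (λ _ _ → L.refl)
        }
      ; inverse = inverseʳ , inverseˡ
      ; ⁻¹-cong = λ {σ} {ρ} p x →
          Inverse.move σ (L.trans (p _) (inverseˡ ρ x))
      }
    }

module _ (K : HeytingField c₁ ℓ₁ ℓ₂) (L : HeytingField c₂ ℓ₃ ℓ₄)
         (ι : HeytingField.Carrier K → HeytingField.Carrier L)
         (ι-emb : IsFieldEmbedding K L ι)
         (S : Pred (HeytingField.Carrier L) h) where

  private
    module K = HeytingField K
    module L = HeytingField L
    module ι = RingMorphisms.IsRingMonomorphism ι-emb

    A : Set _
    A = Σ L.Carrier (Adjoin K L ι S)

    rawAdjoin : RawRing _ _
    rawAdjoin = record
      { Carrier = A
      ; _≈_     = λ x y → proj₁ x L.≈ proj₁ y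
      ; _+_     = λ x y → proj₁ x L.+ proj₁ y , add (proj₂ x) (proj₂ y)
      ; _*_     = λ x y → proj₁ x L.* proj₁ y , mul (proj₂ x) (proj₂ y)
      ; -_      = λ x → L.- proj₁ x , neg (proj₂ x)
      ; 0#      = L.0# , resp ι.0#-homo (base K.0#)
      ; 1#      = L.1# , resp ι.1#-homo (base K.1#)
      }

    inclusion : RingMorphisms.IsRingMonomorphism rawAdjoin (rawField L) proj₁
    inclusion = record
      { isRingHomomorphism = record
        { isSemiringHomomorphism = record
          { isNearSemiringHomomorphism = record
            { +-isMonoidHomomorphism = record
              { isMagmaHomomorphism = record
                { isRelHomomorphism = record { cong = id }
                ; homo = λ _ _ → L.refl
                }
              ; ε-homo = L.refl
              }
            ; *-homo = λ _ _ → L.refl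
            }
          ; 1#-homo = L.refl
          }
        ; -‿homo = λ _ → L.refl
        }
      ; injective = id
      }

  AdjoinField : HeytingField (c₁ ⊔ c₂ ⊔ ℓ₃ ⊔ h) ℓ₃ ℓ₄
  AdjoinField = record
    { RawRing rawAdjoin
    ; _#_ = λ x y → proj₁ x L.# proj₁ y
    ; isHeytingField = record
      { isHeytingCommutativeRing = record
        { isCommutativeRing = RingMono.isCommutativeRing inclusion L.isCommutativeRing
        ; isApartnessRelation = record
          { irrefl  = L.#-irrefl
          ; sym     = L.#-sym
          ; cotrans = λ p z → L.#-cotrans p (proj₁ z)
          }
        ; #⇒invertible = λ {x} {y} p → let (z , zl , zr) = L.#⇒invertible p in
            (z , inv zr (add (proj₂ x) (neg (proj₂ y)))) , zl , zr
        ; invertible⇒# = λ (z , zl , zr) → L.invertible⇒# (proj₁ z , zl , zr)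
        }
      ; tight = λ x y → L.tight (proj₁ x) (proj₁ y)
      }
    }

  adjoinBase : K.Carrier → HeytingField.Carrier AdjoinField
  adjoinBase a = ι a , base a

module _ (K : HeytingField c₁ ℓ₁ ℓ₂) (L : HeytingField c₂ ℓ₃ ℓ₄)
         (ι : HeytingField.Carrier K → HeytingField.Carrier L) where

  private
    module K  = HeytingField K
    module L  = HeytingField L
    module KX = Polynomial (rawField K)
    module LX = Polynomial (rawField L)

  -- The splitting field of f inside L, generated over K by all roots of
  -- f in L; L is meant to be an algebraic closure of K.
  Spl : KX.Poly → Pred L.Carrier (c₁ ⊔ c₂ ⊔ ℓ₃)
  Spl f = Adjoin K L ι (LX.IsRoot (map ι f))

  module _ (ι-emb : IsFieldEmbedding K L ι) (f : KX.Poly) where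

    SplField : HeytingField (c₁ ⊔ c₂ ⊔ ℓ₃) ℓ₃ ℓ₄
    SplField = AdjoinField K L ι ι-emb (LX.IsRoot (map ι f))

    GalSpl : Group (c₁ ⊔ c₂ ⊔ ℓ₃) (c₁ ⊔ c₂ ⊔ ℓ₃)
    GalSpl = Gal K SplField
      (adjoinBase K L ι ι-emb (LX.IsRoot (map ι f)))

    TransitiveOnRoots : Set (c₁ ⊔ c₂ ⊔ ℓ₃)
    TransitiveOnRoots =
      (x y : HeytingField.Carrier SplField) →
      LX.IsRoot (map ι f) (proj₁ x) → LX.IsRoot (map ι f) (proj₁ y) →
      Σ (Group.Carrier GalSpl) λ σ → proj₁ (Automorphism.⟦_⟧ σ x) L.≈ proj₁ y

record Subgroup (G : Group c ℓ) h : Set (c ⊔ ℓ ⊔ Level.suc h) where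
  open Group G
  field
    member    : Pred Carrier h
    ∈-resp    : ∀ {x y} → x ≈ y → member x → member y
    ε-closed  : member ε
    ∙-closed  : ∀ {x y} → member x → member y → member (x ∙ y)
    ⁻¹-closed : ∀ {x} → member x → member (x ⁻¹)

module _ {G : Group c ℓ} where

  private
    module G = Group G
    open GroupProperties G
  open Group G

  subgroupGroup : Subgroup G h → Group (c ⊔ h) ℓ
  subgroupGroup H = record
    { RawGroup raw
    ; isGroup = GroupMono.isGroup inclusion G.isGroup
    }
    where
    open Subgroup H
    raw : RawGroup _ _
    raw = record
      { Carrier = Σ Carrier member
      ; _≈_     = λ x y → proj₁ x ≈ proj₁ y
      ; _∙_     = λ x y → proj₁ x ∙ proj₁ y , ∙-closed (proj₂ x) (proj₂ y)
      ; ε       = ε , ε-closed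
      ; _⁻¹     = λ x → proj₁ x ⁻¹ , ⁻¹-closed (proj₂ x)
      }
    inclusion : GroupMorphisms.IsGroupMonomorphism raw G.rawGroup proj₁
    inclusion = record
      { isGroupHomomorphism = record
        { isMonoidHomomorphism = record
          { isMagmaHomomorphism = record
            { isRelHomomorphism = record { cong = id }
            ; homo = λ _ _ → G.refl
            }
          ; ε-homo = G.refl
          }
        ; ⁻¹-homo = λ _ → G.refl
        }
      ; injective = id
      }

  leftCosets : Subgroup G h → Setoid c h
  leftCosets H = record
    { Carrier = Carrier
    ; _≈_     = λ x y → member (x ⁻¹ ∙ y)
    ; isEquivalence = record
      { refl  = λ {x} → ∈-resp (G.sym (inverseˡ x)) ε-closed
      ; sym   = λ {x} {y} p → ∈-resp
          (G.trans (⁻¹-anti-homo-∙ (x ⁻¹) y) (∙-congˡ (⁻¹-involutive x)))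
          (⁻¹-closed p)
      ; trans = λ {x} {y} {z} p q → ∈-resp
          (G.trans (assoc (x ⁻¹) y (y ⁻¹ ∙ z)) (∙-congˡ (\\-leftDividesˡ y z)))
          (∙-closed p q)
      }
    }
    where open Subgroup H

  HasIndex : Subgroup G h → ℕ → Set (c ⊔ h)
  HasIndex H n = Bijection (≡.setoid (Fin n)) (leftCosets H)

  Conjugate : Subgroup G h₁ → Subgroup G h₂ → Set (c ⊔ h₁ ⊔ h₂)
  Conjugate H K = ∃[ g ] (∀ x → H.member x ⇔ K.member (g ∙ x ∙ g ⁻¹))
    where
    module H = Subgroup H
    module K = Subgroup K

AllIndexConjugate : Group c ℓ → ∀ h → ℕ → Set (c ⊔ ℓ ⊔ Level.suc h)
AllIndexConjugate G h n =
  (H K : Subgroup G h) → HasIndex H n → HasIndex K n → Conjugate H K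

GroupIsomorphic : Group c₁ ℓ₁ → Group c₂ ℓ₂ → Set (c₁ ⊔ c₂ ⊔ ℓ₁ ⊔ ℓ₂)
GroupIsomorphic G H = ∃ (GroupMorphisms.IsGroupIsomorphism (Group.rawGroup G) (Group.rawGroup H))

-- Here σ ∙ τ is "first τ, then σ", whereas π ∘ₚ ρ is "first π, then ρ".
SymmetricGroup : ℕ → Group Level.zero Level.zero
SymmetricGroup n = record
  { Carrier = Permutation′ n
  ; _≈_     = Perm._≈_
  ; _∙_     = λ σ τ → τ ∘ₚ σ
  ; ε       = Perm.id
  ; _⁻¹     = Perm.flip
  ; isGroup = record
    { isMonoid = record
      { isSemigroup = record
        { isMagma = record
          { isEquivalence = record
            { refl  = λ _ → ≡.refl
            ; sym   = λ p i → ≡.sym (p i)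
            ; trans = λ p q i → ≡.trans (p i) (q i)
            }
          ; ∙-cong = λ {σ} {σ′} {τ} {τ′} p q i →
              ≡.trans (≡.cong (σ ⟨$⟩ʳ_) (q i)) (p (τ′ ⟨$⟩ʳ i))
          }
        ; assoc = λ _ _ _ _ → ≡.refl
        }
      ; identity = (λ _ _ → ≡.refl) , (λ _ _ → ≡.refl)
      }
    ; inverse = (λ σ _ → Perm.inverseˡ σ) , (λ σ _ → Perm.inverseʳ σ)
    ; ⁻¹-cong = λ {σ} {τ} p i → ≡.trans
        (≡.cong (σ Perm.⟨$⟩ˡ_) (≡.sym (≡.trans (p (τ Perm.⟨$⟩ˡ i)) (Perm.inverseʳ τ))))
        (Perm.inverseˡ σ)
    }
  }

Transitive : ∀ {n} → Subgroup (SymmetricGroup n) h → Set h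
Transitive H = ∀ i j → ∃[ σ ] (Subgroup.member H σ × σ ⟨$⟩ʳ i ≡ j)

module Submission where

-- Partial automorphisms of the algebraic closure L are handled as subfields T of
-- the ring L × L: an element (0 , y) of T is zero or invertible, hence y = 0, so T
-- is the graph of an isomorphism between subfields of L. Adjoining (γ , γ′) to T,
-- where γ′ is a root of the image of the minimal polynomial of γ, gives a subfield
-- again. Climbing through the roots of a separable f over K in this way shows that
-- an element of the splitting field outside K is moved by some automorphism over K.
--
-- If T permutes the αᵢ by s and the βᵢ by t, it maps c^τ to c^ρ with ρ = t τ s⁻¹.
-- When c_j^τ lies in M, simplicity of F_j forces t τ = τ s, so that s is trivial if
-- and only if t is, and the two splitting fields coincide. Conversely, if they
-- coincide, the stabilisers of α₀ and of β₀ in the common Galois group have index n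
-- and are therefore conjugate. This gives a bijection τ with t τ = τ s for every
-- automorphism, so no automorphism moves c_j^τ, and c_j^τ lies in M.

-- No automorphism of the whole algebraic closure is ever built: extending one to L would in general
-- call for a choice principle beyond excluded middle, while a subfield of L × L grows by one root
-- at a time and only finitely many roots matter. Pairs also save bookkeeping: a list of pairs
-- carries a polynomial together with its image, and interpolation over T computes a Vandermonde
-- solution together with its conjugate. The Galois correspondence is replaced by a count of zeros:
-- a polynomial taking a single value at all conjugates is constant, because its difference from
-- that value, times the cofactor of the minimal polynomial in f, has more zeros than its degree
-- permits. The stabilisers have index n because each Galois group is transitive on its own roots;
-- the isomorphism with G then carries over the conjugacy of subgroups of index n.

open import Defs
open import Level using (Level; _⊔_; Lift; lift; lower)
open import Axiom.ExcludedMiddle using (ExcludedMiddle)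
open import Algebra.Apartness.Bundles using (HeytingField)
open import Algebra.Bundles using (CommutativeRing; Group)
open import Algebra.Bundles.Raw using (RawRing)
import Algebra.Construct.DirectProduct as DirectProduct
import Algebra.Definitions.RawSemiring as RawSemiringDefs
open import Algebra.Morphism.Structures using (module GroupMorphisms; module RingMorphisms)
import Algebra.Properties.CommutativeSemigroup as CommutativeSemigroupProperties
import Algebra.Properties.Group as GroupProperties
import Algebra.Properties.Ring as RingProperties
import Algebra.Properties.Semiring.Mult as Mult
import Algebra.Solver.Ring
open import Algebra.Solver.Ring.AlmostCommutativeRing using (_-Raw-AlmostCommutative⟶_; fromCommutativeRing)
open import Data.Empty using (⊥-elim)
open import Data.Fin.Base using (Fin; zero; suc; toℕ; punchIn)
open import Data.Fin.Permutation as Perm using (Permutation′; permutation; _⟨$⟩ʳ_)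
import Data.Fin.Properties as Fin
open import Data.List.Base as List
  using (List; []; _∷_; _++_; allFin; applyUpTo; length; map; replicate; tabulate)
open import Data.List.Membership.Propositional using (_∈_; find; lose)
open import Data.List.Membership.Propositional.Properties using (∈-allFin)
import Data.List.Properties as List
open import Data.List.Relation.Unary.All as All using (All; []; _∷_)
import Data.List.Relation.Unary.All.Properties as All
open import Data.List.Relation.Unary.AllPairs using (AllPairs; []; _∷_)
import Data.List.Relation.Unary.AllPairs.Properties as AllPairs
open import Data.List.Relation.Unary.Any as Any using (Any; here; there)
import Data.List.Relation.Unary.Any.Properties as Any
open import Data.Maybe.Base using (Maybe; just; nothing)
open import Data.Nat.Base as ℕ using (ℕ; zero; suc; _≤_; _<_; z≤n; s≤s)
open import Data.Nat.Induction using (<-rec)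
import Data.Nat.Properties as ℕ
open import Data.Product.Base using (Σ; ∃; ∃-syntax; _×_; _,_; proj₁; proj₂; swap)
open import Data.Sum.Base as Sum using (_⊎_; inj₁; inj₂)
open import Data.Vec.Functional using (Vector)
open import Function.Base using (_∘_)
open import Function.Bundles using (Equivalence; Injection; _⇔_; mk⇔)
open import Function.Properties.Inverse using (↔⇒↣)
open import Relation.Binary.Bundles using (Setoid)
open import Relation.Binary.PropositionalEquality as ≡ using (_≡_; _≢_)
import Relation.Binary.Reasoning.Setoid as SetoidReasoning
open import Relation.Nullary using (¬_; yes; no)
open import Relation.Unary using (Pred; _⊆_; _≐_)

-- Normalisation of ring identities.

-- The coefficients are formal differences of natural numbers: unlike elements of
-- R they can be compared by computation, so that the solver cancels x - x.
module RingSolver {c ℓ} (R : CommutativeRing c ℓ) where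
  open CommutativeRing R
  open Mult semiring using (×-homo-+; ×1-homo-*) renaming (_×_ to _·_)
  open RingProperties ring
  open SetoidReasoning setoid
  open CommutativeSemigroupProperties +-commutativeSemigroup using (interchange)

  private
    Difference : RawRing _ _
    Difference = record
      { Carrier = ℕ × ℕ ; _≈_ = _≡_
      ; _+_ = λ (a , b) (c , d) → a ℕ.+ c , b ℕ.+ d
      ; _*_ = λ (a , b) (c , d) → a ℕ.* c ℕ.+ b ℕ.* d , a ℕ.* d ℕ.+ b ℕ.* c
      ; -_ = swap ; 0# = 0 , 0 ; 1# = 1 , 0 }

    ⟦_⟧ : ℕ × ℕ → Carrier
    ⟦ a , b ⟧ = a · 1# - b · 1#

    difference-+ : ∀ x y z w → (x + y) - (z + w) ≈ (x - z) + (y - w)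
    difference-+ x y z w = trans (+-congˡ (sym (-‿+-comm z w))) (interchange x y (- z) (- w))

    difference-* : ∀ x y z w → (x * z + y * w) - (x * w + y * z) ≈ (x - y) * (z - w)
    difference-* x y z w = begin
      (x * z + y * w) - (x * w + y * z)    ≈⟨ difference-+ _ _ _ _ ⟩
      (x * z - x * w) + (y * w - y * z)    ≈⟨ +-cong (x[y-z]≈xy-xz x z w) (⁻¹-anti-homo‿- (y * z) (y * w)) ⟨
      x * (z - w) - (y * z - y * w)        ≈⟨ +-congˡ (-‿cong (x[y-z]≈xy-xz y z w)) ⟨
      x * (z - w) - y * (z - w)            ≈⟨ [y-z]x≈yx-zx (z - w) x y ⟨
      (x - y) * (z - w)                    ∎

    homomorphism : Difference -Raw-AlmostCommutative⟶ fromCommutativeRing R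
    homomorphism = record
      { ⟦_⟧ = ⟦_⟧
      ; +-homo = λ (a , b) (c , d) → trans
          (+-cong (×-homo-+ 1# a c) (-‿cong (×-homo-+ 1# b d))) (difference-+ _ _ _ _)
      ; *-homo = λ (a , b) (c , d) → trans
          (+-cong
            (trans (×-homo-+ 1# (a ℕ.* c) (b ℕ.* d)) (+-cong (×1-homo-* a c) (×1-homo-* b d)))
            (-‿cong (trans (×-homo-+ 1# (a ℕ.* d) (b ℕ.* c)) (+-cong (×1-homo-* a d) (×1-homo-* b c)))))
          (difference-* _ _ _ _)
      ; -‿homo = λ (a , b) → sym (⁻¹-anti-homo‿- _ _)
      ; 0-homo = -‿inverseʳ 0#
      ; 1-homo = trans (+-cong (+-identityʳ 1#) -0#≈0#) (+-identityʳ 1#)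
      }

    equal? : ∀ x y → Maybe (⟦ x ⟧ ≈ ⟦ y ⟧)
    equal? (a , b) (c , d) with a ℕ.+ d ℕ.≟ c ℕ.+ b
    ... | no _  = nothing
    ... | yes p = just (begin
      a · 1# - b · 1#                          ≈⟨ xyx⁻¹≈y (d · 1#) _ ⟨
      (d · 1# + (a · 1# - b · 1#)) - d · 1#    ≈⟨ +-congʳ (+-assoc _ _ _) ⟨
      ((d · 1# + a · 1#) - b · 1#) - d · 1#    ≈⟨ +-congʳ (+-congʳ (trans (+-comm _ _) e)) ⟩
      ((c · 1# + b · 1#) - b · 1#) - d · 1#
        ≈⟨ +-congʳ (trans (+-assoc _ _ _) (trans (+-congˡ (-‿inverseʳ _)) (+-identityʳ _))) ⟩
      c · 1# - d · 1#                          ∎)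
      where
      e : a · 1# + d · 1# ≈ c · 1# + b · 1#
      e = trans (sym (×-homo-+ 1# a d)) (trans (reflexive (≡.cong (_· 1#) p)) (×-homo-+ 1# c b))

  open Algebra.Solver.Ring Difference (fromCommutativeRing R) homomorphism equal? public
    using (solve; _:=_; _:+_; _:*_; _:-_; :-_)

-- Arithmetic of polynomials over a commutative ring.

module PolynomialProperties {c ℓ} (R : CommutativeRing c ℓ) where

  open CommutativeRing R hiding (zero)
  open Polynomial rawRing
  open RingProperties ring
  open RawSemiringDefs (RawRing.rawSemiring rawRing) using (_^_)
  open SetoidReasoning setoid
  open RingSolver R

  coeff-+ₚ : ∀ p q i → coeff (p +ₚ q) i ≈ coeff p i + coeff q i
  coeff-+ₚ []      q       i       = sym (+-identityˡ _)
  coeff-+ₚ (a ∷ p) []      i       = sym (+-identityʳ _)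
  coeff-+ₚ (a ∷ p) (b ∷ q) zero    = refl
  coeff-+ₚ (a ∷ p) (b ∷ q) (suc i) = coeff-+ₚ p q i

  coeff-map* : ∀ a p i → coeff (map (a *_) p) i ≈ a * coeff p i
  coeff-map* a []      i       = sym (zeroʳ a)
  coeff-map* a (b ∷ p) zero    = refl
  coeff-map* a (b ∷ p) (suc i) = coeff-map* a p i

  infixr 5 _∷ₛ_
  -- With first entry zero this is multiplication by X on coefficient sequences; it turns the
  -- recursion for products into one equation valid at every index.
  _∷ₛ_ : Carrier → (ℕ → Carrier) → ℕ → Carrier
  (a ∷ₛ f) zero    = a
  (a ∷ₛ f) (suc i) = f i

  coeff-∷*ₚ : ∀ a p q i → coeff ((a ∷ p) *ₚ q) i ≈ a * coeff q i + (0# ∷ₛ coeff (p *ₚ q)) i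
  coeff-∷*ₚ a p q zero    = trans (coeff-+ₚ (map (a *_) q) _ zero) (+-congʳ (coeff-map* a q zero))
  coeff-∷*ₚ a p q (suc i) = trans (coeff-+ₚ (map (a *_) q) _ (suc i)) (+-congʳ (coeff-map* a q (suc i)))

  ∷ₛ-cong : ∀ {f g} → (∀ i → f i ≈ g i) → ∀ i → (0# ∷ₛ f) i ≈ (0# ∷ₛ g) i
  ∷ₛ-cong e zero    = refl
  ∷ₛ-cong e (suc i) = e i

  *ₚ-congˡ : ∀ p {q q′} → q ≈ₚ q′ → p *ₚ q ≈ₚ p *ₚ q′
  *ₚ-congˡ []      e i = refl
  *ₚ-congˡ (a ∷ p) {q} {q′} e i = begin
    coeff ((a ∷ p) *ₚ q) i                       ≈⟨ coeff-∷*ₚ a p q i ⟩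
    a * coeff q i + (0# ∷ₛ coeff (p *ₚ q)) i     ≈⟨ +-cong (*-congˡ (e i)) (∷ₛ-cong (*ₚ-congˡ p e) i) ⟩
    a * coeff q′ i + (0# ∷ₛ coeff (p *ₚ q′)) i   ≈⟨ coeff-∷*ₚ a p q′ i ⟨
    coeff ((a ∷ p) *ₚ q′) i                      ∎

  *ₚ-zeroʳ : ∀ p → p *ₚ [] ≈ₚ []
  *ₚ-zeroʳ []      i       = refl
  *ₚ-zeroʳ (a ∷ p) zero    = refl
  *ₚ-zeroʳ (a ∷ p) (suc i) = *ₚ-zeroʳ p i

  -- Products recurse on the left factor. This is the matching expansion along the right factor; the
  -- two together give `*ₚ-comm` by a single induction.
  coeff-*ₚ∷ : ∀ p b q i → coeff (p *ₚ (b ∷ q)) i ≈ b * coeff p i + (0# ∷ₛ coeff (p *ₚ q)) i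
  coeff-*ₚ∷ []      b q zero    = sym (trans (+-identityʳ _) (zeroʳ b))
  coeff-*ₚ∷ []      b q (suc i) = sym (trans (+-identityʳ _) (zeroʳ b))
  coeff-*ₚ∷ (a ∷ p) b q zero    = +-congʳ (*-comm a b)
  coeff-*ₚ∷ (a ∷ p) b q (suc i) = begin
    coeff ((a ∷ p) *ₚ (b ∷ q)) (suc i)                              ≈⟨ coeff-∷*ₚ a p (b ∷ q) (suc i) ⟩
    a * coeff q i + coeff (p *ₚ (b ∷ q)) i                          ≈⟨ +-congˡ (coeff-*ₚ∷ p b q i) ⟩
    a * coeff q i + (b * coeff p i + (0# ∷ₛ coeff (p *ₚ q)) i)
      ≈⟨ solve 3 (λ x y z → x :+ (y :+ z) := y :+ (x :+ z)) refl _ _ _ ⟩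
    b * coeff p i + (a * coeff q i + (0# ∷ₛ coeff (p *ₚ q)) i)      ≈⟨ +-congˡ (coeff-∷*ₚ a p q i) ⟨
    b * coeff p i + coeff ((a ∷ p) *ₚ q) i                          ∎

  *ₚ-comm : ∀ p q → p *ₚ q ≈ₚ q *ₚ p
  *ₚ-comm []      q i = sym (*ₚ-zeroʳ q i)
  *ₚ-comm (a ∷ p) q i = begin
    coeff ((a ∷ p) *ₚ q) i                    ≈⟨ coeff-∷*ₚ a p q i ⟩
    a * coeff q i + (0# ∷ₛ coeff (p *ₚ q)) i  ≈⟨ +-congˡ (∷ₛ-cong (*ₚ-comm p q) i) ⟩
    a * coeff q i + (0# ∷ₛ coeff (q *ₚ p)) i  ≈⟨ coeff-*ₚ∷ q a p i ⟨
    coeff (q *ₚ (a ∷ p)) i                    ∎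

  *ₚ-congʳ : ∀ {p p′} q → p ≈ₚ p′ → p *ₚ q ≈ₚ p′ *ₚ q
  *ₚ-congʳ {p} {p′} q e i = trans (*ₚ-comm p q i) (trans (*ₚ-congˡ q e i) (*ₚ-comm q p′ i))

  *ₚ-distribʳ : ∀ r p q → (p +ₚ q) *ₚ r ≈ₚ p *ₚ r +ₚ q *ₚ r
  *ₚ-distribʳ r []      q       i = refl
  *ₚ-distribʳ r (a ∷ p) []      i = sym (trans (coeff-+ₚ ((a ∷ p) *ₚ r) [] i) (+-identityʳ _))
  *ₚ-distribʳ r (a ∷ p) (b ∷ q) i = begin
    coeff (((a + b) ∷ (p +ₚ q)) *ₚ r) i
      ≈⟨ coeff-∷*ₚ (a + b) (p +ₚ q) r i ⟩
    (a + b) * coeff r i + (0# ∷ₛ coeff ((p +ₚ q) *ₚ r)) i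
      ≈⟨ +-cong (distribʳ _ a b) (split i) ⟩
    (a * coeff r i + b * coeff r i) + ((0# ∷ₛ coeff (p *ₚ r)) i + (0# ∷ₛ coeff (q *ₚ r)) i)
      ≈⟨ CommutativeSemigroupProperties.interchange +-commutativeSemigroup _ _ _ _ ⟩
    (a * coeff r i + (0# ∷ₛ coeff (p *ₚ r)) i) + (b * coeff r i + (0# ∷ₛ coeff (q *ₚ r)) i)
      ≈⟨ +-cong (coeff-∷*ₚ a p r i) (coeff-∷*ₚ b q r i) ⟨
    coeff ((a ∷ p) *ₚ r) i + coeff ((b ∷ q) *ₚ r) i
      ≈⟨ coeff-+ₚ ((a ∷ p) *ₚ r) ((b ∷ q) *ₚ r) i ⟨
    coeff ((a ∷ p) *ₚ r +ₚ (b ∷ q) *ₚ r) i  ∎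
    where
    split : ∀ i → (0# ∷ₛ coeff ((p +ₚ q) *ₚ r)) i ≈ (0# ∷ₛ coeff (p *ₚ r)) i + (0# ∷ₛ coeff (q *ₚ r)) i
    split zero    = sym (+-identityʳ 0#)
    split (suc i) = trans (*ₚ-distribʳ r p q i) (coeff-+ₚ (p *ₚ r) (q *ₚ r) i)

  map*-*ₚ : ∀ a p q → map (a *_) p *ₚ q ≈ₚ map (a *_) (p *ₚ q)
  map*-*ₚ a []      q i = refl
  map*-*ₚ a (b ∷ p) q i = begin
    coeff ((a * b ∷ map (a *_) p) *ₚ q) i                         ≈⟨ coeff-∷*ₚ (a * b) (map (a *_) p) q i ⟩
    a * b * coeff q i + (0# ∷ₛ coeff (map (a *_) p *ₚ q)) i       ≈⟨ +-cong (*-assoc a b _) (scale i) ⟩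
    a * (b * coeff q i) + a * (0# ∷ₛ coeff (p *ₚ q)) i            ≈⟨ distribˡ a _ _ ⟨
    a * (b * coeff q i + (0# ∷ₛ coeff (p *ₚ q)) i)                ≈⟨ *-congˡ (coeff-∷*ₚ b p q i) ⟨
    a * coeff ((b ∷ p) *ₚ q) i                                    ≈⟨ coeff-map* a ((b ∷ p) *ₚ q) i ⟨
    coeff (map (a *_) ((b ∷ p) *ₚ q)) i                           ∎
    where
    scale : ∀ i → (0# ∷ₛ coeff (map (a *_) p *ₚ q)) i ≈ a * (0# ∷ₛ coeff (p *ₚ q)) i
    scale zero    = sym (zeroʳ a)
    scale (suc i) = trans (map*-*ₚ a p q i) (coeff-map* a (p *ₚ q) i)

  *ₚ-assoc : ∀ p q r → (p *ₚ q) *ₚ r ≈ₚ p *ₚ (q *ₚ r)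
  *ₚ-assoc []      q r i = refl
  *ₚ-assoc (a ∷ p) q r i = begin
    coeff ((map (a *_) q +ₚ (0# ∷ p *ₚ q)) *ₚ r) i
      ≈⟨ *ₚ-distribʳ r (map (a *_) q) (0# ∷ p *ₚ q) i ⟩
    coeff (map (a *_) q *ₚ r +ₚ (0# ∷ p *ₚ q) *ₚ r) i
      ≈⟨ coeff-+ₚ (map (a *_) q *ₚ r) _ i ⟩
    coeff (map (a *_) q *ₚ r) i + coeff ((0# ∷ p *ₚ q) *ₚ r) i
      ≈⟨ +-cong (trans (map*-*ₚ a q r i) (coeff-map* a (q *ₚ r) i))
                (trans (coeff-∷*ₚ 0# (p *ₚ q) r i) (trans (+-congʳ (zeroˡ _)) (+-identityˡ _))) ⟩
    a * coeff (q *ₚ r) i + (0# ∷ₛ coeff ((p *ₚ q) *ₚ r)) i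
      ≈⟨ +-congˡ (∷ₛ-cong (*ₚ-assoc p q r) i) ⟩
    a * coeff (q *ₚ r) i + (0# ∷ₛ coeff (p *ₚ (q *ₚ r))) i
      ≈⟨ coeff-∷*ₚ a p (q *ₚ r) i ⟨
    coeff ((a ∷ p) *ₚ (q *ₚ r)) i  ∎

  *ₚ-identityʳ : ∀ p → p *ₚ C 1# ≈ₚ p
  *ₚ-identityʳ p i = begin
    coeff (p *ₚ C 1#) i                             ≈⟨ coeff-*ₚ∷ p 1# [] i ⟩
    1# * coeff p i + (0# ∷ₛ coeff (p *ₚ [])) i      ≈⟨ +-cong (*-identityˡ _) (vanish i) ⟩
    coeff p i + 0#                                  ≈⟨ +-identityʳ _ ⟩
    coeff p i                                       ∎
    where
    vanish : ∀ i → (0# ∷ₛ coeff (p *ₚ [])) i ≈ 0#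
    vanish zero    = refl
    vanish (suc i) = *ₚ-zeroʳ p i

  eval-+ₚ : ∀ p q x → eval (p +ₚ q) x ≈ eval p x + eval q x
  eval-+ₚ []      q       x = sym (+-identityˡ _)
  eval-+ₚ (a ∷ p) []      x = sym (+-identityʳ _)
  eval-+ₚ (a ∷ p) (b ∷ q) x = trans (+-congˡ (*-congˡ (eval-+ₚ p q x)))
    (solve 5 (λ a b x p q → a :+ b :+ x :* (p :+ q) := a :+ x :* p :+ (b :+ x :* q)) refl a b x _ _)

  eval-map* : ∀ a p x → eval (map (a *_) p) x ≈ a * eval p x
  eval-map* a []      x = sym (zeroʳ a)
  eval-map* a (b ∷ p) x = trans (+-congˡ (*-congˡ (eval-map* a p x)))
    (solve 4 (λ a b x p → a :* b :+ x :* (a :* p) := a :* (b :+ x :* p)) refl a b x _)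

  eval-*ₚ : ∀ p q x → eval (p *ₚ q) x ≈ eval p x * eval q x
  eval-*ₚ []      q x = sym (zeroˡ _)
  eval-*ₚ (a ∷ p) q x = begin
    eval (map (a *_) q +ₚ (0# ∷ p *ₚ q)) x            ≈⟨ eval-+ₚ (map (a *_) q) _ x ⟩
    eval (map (a *_) q) x + (0# + x * eval (p *ₚ q) x)
      ≈⟨ +-cong (eval-map* a q x) (trans (+-identityˡ _) (*-congˡ (eval-*ₚ p q x))) ⟩
    a * eval q x + x * (eval p x * eval q x)
      ≈⟨ solve 4 (λ a q x p → a :* q :+ x :* (p :* q) := (a :+ x :* p) :* q) refl a _ x _ ⟩
    (a + x * eval p x) * eval q x                     ∎

  eval-zero : ∀ {p} x → All (_≈ 0#) p → eval p x ≈ 0#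
  eval-zero x []       = refl
  eval-zero x (e ∷ es) = trans (+-cong e (trans (*-congˡ (eval-zero x es)) (zeroʳ x))) (+-identityʳ 0#)

  coeff-zero : ∀ {p} → All (_≈ 0#) p → p ≈ₚ []
  coeff-zero []       i       = refl
  coeff-zero (e ∷ es) zero    = e
  coeff-zero (e ∷ es) (suc i) = coeff-zero es i

  ≈ₚ[]⇒zero : ∀ p → p ≈ₚ [] → All (_≈ 0#) p
  ≈ₚ[]⇒zero []      e = []
  ≈ₚ[]⇒zero (a ∷ p) e = e 0 ∷ ≈ₚ[]⇒zero p (λ i → e (suc i))

  eval-congˡ : ∀ p q x → p ≈ₚ q → eval p x ≈ eval q x
  eval-congˡ []      q       x e = sym (eval-zero x (≈ₚ[]⇒zero q (λ i → sym (e i))))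
  eval-congˡ (a ∷ p) []      x e = eval-zero x (≈ₚ[]⇒zero (a ∷ p) e)
  eval-congˡ (a ∷ p) (b ∷ q) x e = +-cong (e 0) (*-congˡ (eval-congˡ p q x (λ i → e (suc i))))

  eval-X- : ∀ y x → eval (X- y) x ≈ x - y
  eval-X- y x = trans (+-cong (+-identityˡ (- y)) (*-congˡ (trans (+-congˡ (zeroʳ x)) (+-identityʳ 1#))))
    (trans (+-congˡ (*-identityʳ x)) (+-comm (- y) x))

  length-+ₚ : ∀ p q → length (p +ₚ q) ≡ length p ℕ.⊔ length q
  length-+ₚ []      q       = ≡.refl
  length-+ₚ (a ∷ p) []      = ≡.refl
  length-+ₚ (a ∷ p) (b ∷ q) = ≡.cong suc (length-+ₚ p q)

  length-+ₚ-≡ : ∀ p q → length p ≡ length q → length (p +ₚ q) ≡ length q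
  length-+ₚ-≡ p q e = ≡.trans (length-+ₚ p q) (≡.trans (≡.cong (ℕ._⊔ length q) e) (ℕ.⊔-idem _))

  -- A list of length l has degree below l, so lengths add up to one too many; bounding `q` by
  -- `suc k` avoids a truncated subtraction.
  length-*ₚ : ∀ p q {k} → length q ≤ suc k → length (p *ₚ q) ≤ length p ℕ.+ k
  length-*ₚ []      q l = z≤n
  length-*ₚ (a ∷ p) q {k} l = ℕ.≤-trans
    (ℕ.≤-reflexive (≡.trans (length-+ₚ (map (a *_) q) _) (≡.cong (ℕ._⊔ _) (List.length-map (a *_) q))))
    (ℕ.⊔-lub (ℕ.≤-trans l (s≤s (ℕ.m≤n+m k (length p)))) (s≤s (length-*ₚ p q l)))

  -- u lists the coefficients below the leading one, so that the degree is length u.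
  monic : Poly → Poly
  monic u = u ++ 1# ∷ []

  eval-∷ʳ : ∀ u t x → eval (u ++ t ∷ []) x ≈ eval u x + t * x ^ length u
  eval-∷ʳ []      t x = trans (+-congˡ (zeroʳ x)) (trans (+-comm t 0#) (+-congˡ (sym (*-identityʳ t))))
  eval-∷ʳ (a ∷ u) t x = trans (+-congˡ (*-congˡ (eval-∷ʳ u t x)))
    (solve 5 (λ a x u t e → a :+ x :* (u :+ t :* e) := a :+ x :* u :+ t :* (x :* e)) refl a x _ t _)

  eval-monic : ∀ u x → eval (monic u) x ≈ eval u x + x ^ length u
  eval-monic u x = trans (eval-∷ʳ u 1# x) (+-congˡ (*-identityˡ _))

  length-monic : ∀ u → length (monic u) ≡ suc (length u)
  length-monic u = ≡.trans (List.length-++ u) (ℕ.+-comm (length u) 1)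

  monic-nonzero : ¬ 1# ≈ 0# → ∀ u → ¬ All (_≈ 0#) (monic u)
  monic-nonzero 1≉0 u z with e ∷ [] ← All.++⁻ʳ u z = 1≉0 e

  record IsSubring {s} (S : Pred Carrier s) : Set (c ⊔ ℓ ⊔ s) where
    field
      ≈-closed : ∀ {x y} → x ≈ y → S x → S y
      1-closed : S 1#
      +-closed : ∀ {x y} → S x → S y → S (x + y)
      *-closed : ∀ {x y} → S x → S y → S (x * y)
      -‿closed : ∀ {x} → S x → S (- x)

    0-closed : S 0#
    0-closed = ≈-closed (-‿inverseʳ 1#) (+-closed 1-closed (-‿closed 1-closed))

    +ₚ-closed : ∀ {p q} → All S p → All S q → All S (p +ₚ q)
    +ₚ-closed []       qs       = qs
    +ₚ-closed (a ∷ ps) []       = a ∷ ps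
    +ₚ-closed (a ∷ ps) (b ∷ qs) = +-closed a b ∷ +ₚ-closed ps qs

    map*-closed : ∀ {a p} → S a → All S p → All S (map (a *_) p)
    map*-closed a ps = All.map⁺ (All.map (*-closed a) ps)

    *ₚ-closed : ∀ {p q} → All S p → All S q → All S (p *ₚ q)
    *ₚ-closed []       qs = []
    *ₚ-closed (a ∷ ps) qs = +ₚ-closed (map*-closed a qs) (0-closed ∷ *ₚ-closed ps qs)

    monic-closed : ∀ {u} → All S u → All S (monic u)
    monic-closed us = All.++⁺ us (1-closed ∷ [])

    eval-closed : ∀ {p x} → All S p → S x → S (eval p x)
    eval-closed []       x = 0-closed
    eval-closed (a ∷ ps) x = +-closed a (*-closed x (eval-closed ps x))

    coeff-closed : ∀ {p} → All S p → ∀ i → S (coeff p i)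
    coeff-closed []       i       = 0-closed
    coeff-closed (a ∷ ps) zero    = a
    coeff-closed (a ∷ ps) (suc i) = coeff-closed ps i

  -- Division with remainder by a monic polynomial over a subring.

  module Division {s} {S : Pred Carrier s} (S-subring : IsSubring S) where

    open IsSubring S-subring

    initLast : ∀ {a r} → S a → All S r →
      ∃[ i ] ∃[ t ] (a ∷ r ≡ i ++ t ∷ [] × length i ≡ length r × All S i × S t)
    initLast a []       = [] , _ , ≡.refl , ≡.refl , [] , a
    initLast a (b ∷ rs) with i , t , e , l , is , ts ← initLast b rs =
      _ ∷ i , t , ≡.cong (_ ∷_) e , ≡.cong suc l , a ∷ is , ts

    module _ {u} (us : All S u) where

      -- One step of long division. Only the top coefficient `t` of a + X r reaches degree
      -- `length u`, and subtracting `t` times the divisor removes it; the divisor being monic,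
      -- nothing has to be inverted.
      reduce-∷ : ∀ {a r} → S a → All S r → length r ≡ length u →
        ∃[ t ] ∃[ r′ ] (S t × All S r′ × length r′ ≡ length u ×
          (∀ x → eval (a ∷ r) x ≈ t * eval (monic u) x + eval r′ x))
      reduce-∷ {a} {r} a∈S rs l with i , t , e , l′ , is , ts ← initLast a∈S rs =
        t , i +ₚ map (- t *_) u , ts , +ₚ-closed is (map*-closed (-‿closed ts) us) ,
        ≡.trans (length-+ₚ-≡ i _ (≡.trans (≡.trans l′ l) (≡.sym (List.length-map _ u)))) (List.length-map _ u) ,
        λ x → begin
          eval (a ∷ r) x                                ≡⟨ ≡.cong (λ p → eval p x) e ⟩
          eval (i ++ t ∷ []) x                          ≈⟨ eval-∷ʳ i t x ⟩
          eval i x + t * x ^ length i                   ≡⟨ ≡.cong (λ n → eval i x + t * x ^ n) (≡.trans l′ l) ⟩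
          eval i x + t * x ^ length u
            ≈⟨ solve 4 (λ t u e i → i :+ t :* e := t :* (u :+ e) :+ (i :+ :- t :* u)) refl t (eval u x) _ _ ⟩
          t * (eval u x + x ^ length u) + (eval i x + - t * eval u x)
            ≈⟨ +-cong (*-congˡ (sym (eval-monic u x))) (trans (+-congˡ (sym (eval-map* (- t) u x))) (sym (eval-+ₚ i _ x))) ⟩
          t * eval (monic u) x + eval (i +ₚ map (- t *_) u) x ∎

      -- An identity of values is enough: divisions are only ever evaluated, at a generator or at
      -- roots.
      Divides : Poly → Poly → Poly → Set (c ⊔ ℓ)
      Divides p q r = ∀ x → eval p x ≈ eval q x * eval (monic u) x + eval r x

      divide-∷ : ∀ {a p q r} → S a → All S r → length r ≡ length u → Divides p q r →
        ∃[ t ] ∃[ r′ ] (S t × All S r′ × length r′ ≡ length u × Divides (a ∷ p) (t ∷ q) r′)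
      divide-∷ {a} {p} {q} {r} a∈S rs l e =
        let t , r′ , t∈S , rs′ , l′ , e′ = reduce-∷ a∈S rs l in
        t , r′ , t∈S , rs′ , l′ , λ x → begin
          a + x * eval p x
            ≈⟨ +-congˡ (*-congˡ (e x)) ⟩
          a + x * (eval q x * eval (monic u) x + eval r x)
            ≈⟨ solve 5 (λ a x q m r → a :+ x :* (q :* m :+ r) := x :* (q :* m) :+ (a :+ x :* r)) refl a x _ _ _ ⟩
          x * (eval q x * eval (monic u) x) + eval (a ∷ r) x
            ≈⟨ +-congˡ (e′ x) ⟩
          x * (eval q x * eval (monic u) x) + (t * eval (monic u) x + eval r′ x)
            ≈⟨ solve 5 (λ t x q m r → x :* (q :* m) :+ (t :* m :+ r) := (t :+ x :* q) :* m :+ r) refl t x _ _ _ ⟩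
          (t + x * eval q x) * eval (monic u) x + eval r′ x ∎

      divide : ∀ {p} → All S p → ∃[ q ] ∃[ r ] (All S r × length r ≡ length u × Divides p q r)
      -- The zero remainder is padded to length exactly `length u`, as `reduce-∷` demands.
      divide [] = [] , replicate (length u) 0# , All.replicate⁺ (length u) 0-closed , List.length-replicate (length u) ,
        λ x → sym (trans (+-cong (zeroˡ _) (eval-zero x (All.replicate⁺ (length u) refl))) (+-identityʳ 0#))
      divide {_ ∷ p} (a ∷ ps) =
        let q , r , rs , l , e = divide ps
            t , r′ , _ , rs′ , l′ , e′ = divide-∷ {p = p} {q = q} a rs l e
        in t ∷ q , r′ , rs′ , l′ , e′

      -- A monic dividend has a monic quotient of known degree. That keeps the quotient nonzero,
      -- which the irreducibility argument and the later count of zeros rely on.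
      divide-monic : ∀ k {v} → All S v → length v ≡ k ℕ.+ length u →
        ∃[ q ] ∃[ r ] (All S q × All S r × length q ≡ k × length r ≡ length u × Divides (monic v) (monic q) r)
      divide-monic zero {v} vs l = [] , v +ₚ map (- 1# *_) u , [] , +ₚ-closed vs (map*-closed (-‿closed 1-closed) us) , ≡.refl ,
        ≡.trans (length-+ₚ-≡ v _ (≡.trans l (≡.sym (List.length-map _ u)))) (List.length-map _ u) ,
        λ x → begin
          eval (monic v) x                  ≈⟨ eval-monic v x ⟩
          eval v x + x ^ length v           ≡⟨ ≡.cong (λ n → eval v x + x ^ n) l ⟩
          eval v x + x ^ length u
            ≈⟨ solve 3 (λ v e u → v :+ e := (u :+ e) :+ (v :- u)) refl (eval v x) _ (eval u x) ⟩
          (eval u x + x ^ length u) + (eval v x - eval u x)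
            ≈⟨ +-cong (trans (sym (eval-monic u x)) (sym (*-identityˡ _))) (+-congˡ (sym (-1*x≈-x _))) ⟩
          1# * eval (monic u) x + (eval v x + - 1# * eval u x)
            ≈⟨ +-cong (*-congʳ (sym (trans (+-congˡ (zeroʳ x)) (+-identityʳ 1#))))
                 (trans (+-congˡ (sym (eval-map* (- 1#) u x))) (sym (eval-+ₚ v _ x))) ⟩
          eval (monic []) x * eval (monic u) x + eval (v +ₚ map (- 1# *_) u) x ∎
      divide-monic (suc k) {a ∷ v} (a∈S ∷ vs) l =
        let q , r , qs , rs , lq , lr , e = divide-monic k vs (ℕ.suc-injective l)
            t , r′ , t∈S , rs′ , l′ , e′ = divide-∷ {p = monic v} {q = monic q} a∈S rs lr e
        in t ∷ q , r′ , t∈S ∷ qs , rs′ , ≡.cong suc lq , l′ , e′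

  -- Subfields and simple extensions.

  -- R itself need not be a field: a subfield of a product of two fields is the
  -- graph of a partial isomorphism.
  record IsSubfield {s} (S : Pred Carrier s) : Set (c ⊔ ℓ ⊔ s) where
    field
      isSubring : IsSubring S
      inverse   : ∀ {x} → S x → x ≈ 0# ⊎ (∃[ y ] (S y × x * y ≈ 1#))

    open IsSubring isSubring public

  module _ {s} {S : Pred Carrier s} (S-subfield : IsSubfield S) where

    open IsSubfield S-subfield
    open Division isSubring

    Normalised : Poly → Set _
    Normalised p = ∃[ a ] ∃[ b ] ∃[ u ] (S a × S b × a * b ≈ 1# × All S u × length u < length p ×
      (∀ x → eval p x ≈ a * eval (monic u) x))

    -- Zeros at the top are dropped and the last nonzero coefficient is factored out. Zero divisors
    -- of the ambient ring do no harm, since an element of `S` is zero or has an inverse in `S`.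
    normalise : ∀ {p} → All S p → All (_≈ 0#) p ⊎ Normalised p
    normalise [] = inj₁ []
    normalise (a∈S ∷ ps) with normalise ps
    normalise {a ∷ p} (a∈S ∷ ps) | inj₂ (c , d , u , c∈S , d∈S , cd , us , l , e) =
      inj₂ (c , d , a * d ∷ u , c∈S , d∈S , cd , *-closed a∈S d∈S ∷ us , s≤s l , λ x → begin
        a + x * eval p x
          ≈⟨ +-cong (trans (sym (*-identityʳ a)) (*-congˡ (sym cd))) (*-congˡ (e x)) ⟩
        a * (c * d) + x * (c * eval (monic u) x)
          ≈⟨ solve 5 (λ a c d x m → a :* (c :* d) :+ x :* (c :* m) := c :* (a :* d :+ x :* m)) refl a c d x _ ⟩
        c * (a * d + x * eval (monic u) x)     ∎)
    normalise {a ∷ p} (a∈S ∷ ps) | inj₁ zs with inverse a∈S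
    ... | inj₁ a≈0 = inj₁ (a≈0 ∷ zs)
    ... | inj₂ (b , b∈S , ab) = inj₂ (a , b , [] , a∈S , b∈S , ab , [] , s≤s z≤n , λ x → begin
        a + x * eval p x  ≈⟨ +-congˡ (trans (*-congˡ (eval-zero x zs)) (zeroʳ x)) ⟩
        a + 0#            ≈⟨ +-identityʳ a ⟩
        a                 ≈⟨ *-identityʳ a ⟨
        a * 1#            ≈⟨ *-congˡ (trans (+-congˡ (zeroʳ x)) (+-identityʳ 1#)) ⟨
        a * (1# + x * 0#) ∎)

    infix 8 _[_]

    _[_] : Carrier → Pred Carrier (c ⊔ ℓ ⊔ s)
    _[_] ζ z = ∃[ p ] (All S p × z ≈ eval p ζ)

    module _ (ζ : Carrier) where

      adjoin-⊇ : ∀ {x} → S x → _[_] ζ x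
      adjoin-⊇ {x} x∈S = C x , x∈S ∷ [] , sym (trans (+-congˡ (zeroʳ ζ)) (+-identityʳ x))

      adjoin-∋ : _[_] ζ ζ
      adjoin-∋ = X , 0-closed ∷ 1-closed ∷ [] ,
        sym (trans (+-identityˡ _) (trans (*-congˡ (trans (+-congˡ (zeroʳ ζ)) (+-identityʳ 1#))) (*-identityʳ ζ)))

      adjoin-isSubring : IsSubring (_[_] ζ)
      adjoin-isSubring = record
        { ≈-closed = λ { e (p , ps , z) → p , ps , trans (sym e) z }
        ; 1-closed = adjoin-⊇ 1-closed
        ; +-closed = λ { (p , ps , z) (q , qs , w) → p +ₚ q , +ₚ-closed ps qs , trans (+-cong z w) (sym (eval-+ₚ p q ζ)) }
        ; *-closed = λ { (p , ps , z) (q , qs , w) → p *ₚ q , *ₚ-closed ps qs , trans (*-cong z w) (sym (eval-*ₚ p q ζ)) }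
        ; -‿closed = λ { (p , ps , z) → map (- 1# *_) p , map*-closed (-‿closed 1-closed) ps ,
            trans (-‿cong z) (trans (sym (-1*x≈-x _)) (sym (eval-map* (- 1#) p ζ))) }
        }

      -- ζ is a root of a monic u that is irreducible over S, in the sense that
      -- no two nonzero polynomials of smaller degree have a product vanishing at ζ.
      module _ (1≉0 : ¬ 1# ≈ 0#) {u} (us : All S u) (root : eval (monic u) ζ ≈ 0#)
        (irreducible : ∀ {p q} → All S p → All S q → length p ≤ length u → length q ≤ length u →
           eval p ζ * eval q ζ ≈ 0# → All (_≈ 0#) p ⊎ All (_≈ 0#) q) where

        -- Euclid's algorithm: dividing u by v leaves an invertible remainder.
        monic-invertible : ∀ n {v} → All S v → length v < n → n ≤ length u →
          ∃[ s ] (All S s × eval (monic v) ζ * eval s ζ ≈ 1#)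
        monic-invertible (suc n) {[]} vs l n≤ =
          C 1# , 1-closed ∷ [] , trans (*-cong one one) (*-identityʳ 1#)
          where
          one = trans (+-congˡ (zeroʳ ζ)) (+-identityʳ 1#)
        monic-invertible (suc n) {v@(_ ∷ v′)} vs (s≤s l) n≤
          with q , r , qs , rs , lq , lr , e ←
            divide-monic vs (length u ℕ.∸ length v) us (≡.sym (ℕ.m∸n+n≡m (ℕ.≤-trans (ℕ.m≤n⇒m≤1+n l) n≤)))
          with normalise rs
        -- Now the product of `monic q` and `monic v` vanishes at ζ. Both degrees are below that of
        -- `monic u`: for `v` by assumption, for `q` because `v` is nonempty.
        ... | inj₁ zs = ⊥-elim (Sum.[ monic-nonzero 1≉0 q , monic-nonzero 1≉0 v ]
          (irreducible (monic-closed qs) (monic-closed vs)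
            (ℕ.≤-trans (ℕ.≤-reflexive (≡.trans (length-monic q) (≡.cong suc lq))) short)
            (ℕ.≤-trans (ℕ.≤-reflexive (length-monic v)) (ℕ.≤-trans (s≤s l) n≤))
            (trans (sym (trans (e ζ) (trans (+-congˡ (eval-zero ζ zs)) (+-identityʳ _)))) root)))
          where
          short : suc (length u ℕ.∸ length v) ≤ length u
          short = ℕ.≤-trans (ℕ.≤-reflexive (≡.sym (ℕ.+-∸-assoc 1 (ℕ.≤-trans (ℕ.m≤n⇒m≤1+n l) n≤)))) (ℕ.m∸n≤m (length u) (length v′))
        ... | inj₂ (a , b , w , a∈S , b∈S , ab , ws , lw , e′)
          with s , ss , e″ ← monic-invertible n ws (ℕ.<-≤-trans lw (ℕ.≤-trans (ℕ.≤-reflexive lr) l)) (ℕ.≤-trans (ℕ.n≤1+n n) n≤) =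
          -- At ζ the division reads 0 = Q V + a W. With W s = 1 and a b = 1 this gives V (- b Q s)
          -- = b a W s = 1.
          map (- b *_) (monic q *ₚ s) , map*-closed (-‿closed b∈S) (*ₚ-closed (monic-closed qs) ss) , (begin
            V * eval (map (- b *_) (monic q *ₚ s)) ζ
              ≈⟨ *-congˡ (trans (eval-map* (- b) (monic q *ₚ s) ζ) (*-congˡ (eval-*ₚ (monic q) s ζ))) ⟩
            V * (- b * (Q * eval s ζ))
              ≈⟨ solve 6 (λ V b Q s a W → V :* (:- b :* (Q :* s)) :=
                   (a :* b) :* (W :* s) :- (Q :* V :+ a :* W) :* (b :* s)) refl V b Q _ a W ⟩
            (a * b) * (W * eval s ζ) - (Q * V + a * W) * (b * eval s ζ)
              ≈⟨ +-cong (*-cong ab e″) (-‿cong (trans (*-congʳ (trans (+-congˡ (sym (e′ ζ))) (trans (sym (e ζ)) root))) (zeroˡ _))) ⟩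
            1# * 1# - 0#                              ≈⟨ +-cong (*-identityʳ 1#) -0#≈0# ⟩
            1# + 0#                                   ≈⟨ +-identityʳ 1# ⟩
            1#                                        ∎)
          where
          V = eval (monic v) ζ
          Q = eval (monic q) ζ
          W = eval (monic w) ζ

        adjoin-isSubfield : IsSubfield (_[_] ζ)
        adjoin-isSubfield = record { isSubring = adjoin-isSubring ; inverse = zero-or-unit }
          where
          zero-or-unit : ∀ {z} → _[_] ζ z → z ≈ 0# ⊎ (∃[ y ] (_[_] ζ y × z * y ≈ 1#))
          zero-or-unit {z} (p , ps , e)
            with q , r , rs , lr , e′ ← divide us ps
            with z≈r ← trans e (trans (e′ ζ) (trans (+-congʳ (trans (*-congˡ root) (zeroʳ _))) (+-identityˡ _)))
            with normalise rs
          ... | inj₁ zs = inj₁ (trans z≈r (eval-zero ζ zs))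
          ... | inj₂ (a , b , w , a∈S , b∈S , ab , ws , lw , e″)
            with s , ss , e‴ ← monic-invertible (length u) ws (ℕ.<-≤-trans lw (ℕ.≤-reflexive lr)) ℕ.≤-refl =
            inj₂ (eval (map (b *_) s) ζ , (_ , map*-closed b∈S ss , refl) , (begin
              z * eval (map (b *_) s) ζ               ≈⟨ *-cong (trans z≈r (e″ ζ)) (eval-map* b s ζ) ⟩
              (a * eval (monic w) ζ) * (b * eval s ζ)
                ≈⟨ solve 4 (λ a w b s → (a :* w) :* (b :* s) := (a :* b) :* (w :* s)) refl a _ b _ ⟩
              (a * b) * (eval (monic w) ζ * eval s ζ) ≈⟨ *-cong ab e‴ ⟩
              1# * 1#                                 ≈⟨ *-identityʳ 1# ⟩
              1#                                      ∎))

-- Interpolation with coefficients in a subring.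

module Interpolation {c ℓ} (R : CommutativeRing c ℓ) where

  open CommutativeRing R hiding (zero)
  open Polynomial rawRing
  open PolynomialProperties R
  open RingProperties ring
  open SetoidReasoning setoid
  open RingSolver R

  module _ {s} {S : Pred Carrier s} (S-subring : IsSubring S) where

    open IsSubring S-subring

    -- Newton's scheme: p = y + (X - x) p′, where p′ interpolates the divided differences (yᵢ - y) /
    -- (xᵢ - x). Only differences of nodes are inverted, and inside `S`, so the coefficients stay in
    -- `S`.
    interpolate : ∀ {n} (xs ys : Vector Carrier n) → (∀ i → S (xs i)) → (∀ i → S (ys i)) →
      (∀ {i j} → i ≢ j → ∃[ w ] (S w × (xs i - xs j) * w ≈ 1#)) →
      ∃[ p ] (All S p × length p ≡ n × (∀ i → eval p (xs i) ≈ ys i))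
    interpolate {zero}  xs ys xs∈S ys∈S inverses = [] , [] , ≡.refl , λ ()
    interpolate {suc n} xs ys xs∈S ys∈S inverses =
      (y ∷ p) +ₚ map (- x *_) p ,
      +ₚ-closed (ys∈S zero ∷ ps) (map*-closed (-‿closed (xs∈S zero)) ps) ,
      ≡.trans (length-+ₚ (y ∷ p) (map (- x *_) p)) (≡.trans (≡.cong (suc (length p) ℕ.⊔_) (List.length-map _ p))
        (≡.trans (ℕ.m≥n⇒m⊔n≡m (ℕ.n≤1+n _)) (≡.cong suc (proj₁ (proj₂ (proj₂ ih)))))) ,
      values
      where
      x = xs zero
      y = ys zero
      w : ∀ i → ∃[ w ] (S w × (xs (suc i) - x) * w ≈ 1#)
      w i = inverses {suc i} {zero} λ ()
      ih = interpolate (λ i → xs (suc i)) (λ i → (ys (suc i) - y) * proj₁ (w i)) (λ i → xs∈S (suc i))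
        (λ i → *-closed (+-closed (ys∈S (suc i)) (-‿closed (ys∈S zero))) (proj₁ (proj₂ (w i))))
        (λ i≢j → inverses (i≢j ∘ Fin.suc-injective))
      p = proj₁ ih
      ps = proj₁ (proj₂ ih)
      expand : ∀ z → eval ((y ∷ p) +ₚ map (- x *_) p) z ≈ y + (z - x) * eval p z
      expand z = begin
        eval ((y ∷ p) +ₚ map (- x *_) p) z              ≈⟨ eval-+ₚ (y ∷ p) (map (- x *_) p) z ⟩
        (y + z * eval p z) + eval (map (- x *_) p) z    ≈⟨ +-congˡ (eval-map* (- x) p z) ⟩
        (y + z * eval p z) + - x * eval p z
          ≈⟨ solve 4 (λ y z x p → (y :+ z :* p) :+ :- x :* p := y :+ (z :- x) :* p) refl y z x _ ⟩
        y + (z - x) * eval p z                          ∎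
      values : ∀ i → eval ((y ∷ p) +ₚ map (- x *_) p) (xs i) ≈ ys i
      values zero    = trans (expand x) (trans (+-congˡ (trans (*-congʳ (-‿inverseʳ x)) (zeroˡ _))) (+-identityʳ y))
      values (suc i) = begin
        eval ((y ∷ p) +ₚ map (- x *_) p) (xs (suc i))                     ≈⟨ expand _ ⟩
        y + (xs (suc i) - x) * eval p (xs (suc i))
          ≈⟨ +-congˡ (*-congˡ (proj₂ (proj₂ (proj₂ ih)) i)) ⟩
        y + (xs (suc i) - x) * ((ys (suc i) - y) * proj₁ (w i))
          ≈⟨ solve 4 (λ y d b w → y :+ d :* (b :* w) := y :+ (d :* w) :* b) refl y _ _ _ ⟩
        y + ((xs (suc i) - x) * proj₁ (w i)) * (ys (suc i) - y)
          ≈⟨ +-congˡ (trans (*-congʳ (proj₂ (proj₂ (w i)))) (*-identityˡ _)) ⟩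
        y + (ys (suc i) - y)
          ≈⟨ solve 2 (λ y z → y :+ (z :- y) := z) refl y _ ⟩
        ys (suc i)                                                        ∎

-- Zeros of polynomials over a field with excluded middle.

module ClassicalField (em : ∀ {ℓ} → ExcludedMiddle ℓ) {c ℓ ℓ′} (L : HeytingField c ℓ ℓ′) where

  open CommutativeRing (fieldRing L) hiding (zero)
  open HeytingField L using (_#_; #⇒invertible; invertible⇒#; #-irrefl; tight)
  open Polynomial rawRing
  open PolynomialProperties (fieldRing L)
  open RingProperties ring
  open SetoidReasoning setoid
  open RingSolver (fieldRing L)

  1≉0 : ¬ 1# ≈ 0#
  1≉0 e = #-irrefl e (invertible⇒# (1# , 1*[1-0]≈1 , trans (*-comm _ _) 1*[1-0]≈1))
    where
    1*[1-0]≈1 : 1# * (1# - 0#) ≈ 1#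
    1*[1-0]≈1 = trans (*-identityˡ _) (trans (+-congˡ -0#≈0#) (+-identityʳ 1#))

  invertible : ∀ {x} → ¬ x ≈ 0# → ∃[ y ] x * y ≈ 1#
  invertible {x} x≉0 with em {P = x # 0#}
  ... | no ¬x#0 = ⊥-elim (x≉0 (proj₁ (tight x 0#) ¬x#0))
  ... | yes x#0 with y , _ , xy≈1 ← #⇒invertible x#0 =
    y , trans (*-congʳ (sym (trans (+-congˡ -0#≈0#) (+-identityʳ x)))) xy≈1

  unit-nonzero : ∀ {x y} → x * y ≈ 1# → ¬ x ≈ 0#
  unit-nonzero xy≈1 x≈0 = 1≉0 (trans (sym xy≈1) (trans (*-congʳ x≈0) (zeroˡ _)))

  *-cancel-zero : ∀ {x y} → ¬ x ≈ 0# → x * y ≈ 0# → y ≈ 0#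
  *-cancel-zero {x} {y} x≉0 xy≈0 with z , xz≈1 ← invertible x≉0 = begin
    y             ≈⟨ *-identityˡ y ⟨
    1# * y        ≈⟨ *-congʳ xz≈1 ⟨
    (x * z) * y   ≈⟨ solve 3 (λ x z y → (x :* z) :* y := z :* (x :* y)) refl x z y ⟩
    z * (x * y)   ≈⟨ trans (*-congˡ xy≈0) (zeroʳ z) ⟩
    0#            ∎

  integral : ∀ {x y} → x * y ≈ 0# → x ≈ 0# ⊎ y ≈ 0#
  integral {x} {y} xy≈0 with em {P = x ≈ 0#}
  ... | yes x≈0 = inj₁ x≈0
  ... | no x≉0  = inj₂ (*-cancel-zero x≉0 xy≈0)

  -≈0⇒≈ : ∀ {x y} → x - y ≈ 0# → x ≈ y
  -≈0⇒≈ {x} {y} = x∙y⁻¹≈ε⇒x≈y x y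

  Distinct : ∀ {n} → Vector Carrier n → Set ℓ
  Distinct zs = ∀ {i j} → zs i ≈ zs j → i ≡ j

  -- (p (x) - p (z)) / (x - z) for p = a + X p′; it does not depend on a.
  difference-quotient : Carrier → Poly → Poly
  difference-quotient z []       = []
  difference-quotient z (b ∷ p′) = eval (b ∷ p′) z ∷ difference-quotient z p′

  length-difference-quotient : ∀ z p′ → length (difference-quotient z p′) ≡ length p′
  length-difference-quotient z []       = ≡.refl
  length-difference-quotient z (b ∷ p′) = ≡.cong suc (length-difference-quotient z p′)

  eval-difference-quotient : ∀ z a p′ x →
    eval (a ∷ p′) x ≈ eval (a ∷ p′) z + (x - z) * eval (difference-quotient z p′) x
  eval-difference-quotient z a []       x =
    trans (+-congˡ (trans (zeroʳ x) (sym (zeroʳ z)))) (sym (trans (+-congˡ (zeroʳ _)) (+-identityʳ _)))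
  eval-difference-quotient z a (b ∷ p′) x = begin
    a + x * eval (b ∷ p′) x
      ≈⟨ +-congˡ (*-congˡ (eval-difference-quotient z b p′ x)) ⟩
    a + x * (eval (b ∷ p′) z + (x - z) * eval (difference-quotient z p′) x)
      ≈⟨ solve 5 (λ a x z p d → a :+ x :* (p :+ (x :- z) :* d) := (a :+ z :* p) :+ (x :- z) :* (p :+ x :* d)) refl a x z _ _ ⟩
    (a + z * eval (b ∷ p′) z) + (x - z) * (eval (b ∷ p′) z + x * eval (difference-quotient z p′) x)  ∎

  -- The entries are the values at z of the successive tails of `p′`, as in Horner's scheme, so
  -- vanishing spreads downwards from the leading coefficient.
  difference-quotient-zero : ∀ z p′ → All (_≈ 0#) (difference-quotient z p′) → All (_≈ 0#) p′
  difference-quotient-zero z []       []       = []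
  difference-quotient-zero z (b ∷ p′) (e ∷ es) =
    trans (sym (trans (+-congˡ (trans (*-congˡ (eval-zero z zs)) (zeroʳ z))) (+-identityʳ b))) e ∷ zs
    where zs = difference-quotient-zero z p′ es

  -- Dividing out X - z for the first zero z leaves a shorter list that still vanishes at the other
  -- points.
  few-roots : ∀ {n} (zs : Vector Carrier n) → Distinct zs → ∀ p → length p ≤ n →
    (∀ i → eval p (zs i) ≈ 0#) → All (_≈ 0#) p
  few-roots             zs distinct []       l       roots = []
  few-roots {suc n} zs distinct (a ∷ p) (s≤s l) roots = a≈0 ∷ p-zero
    where
    z = zs zero
    p-zero : All (_≈ 0#) p
    p-zero = difference-quotient-zero z p (few-roots (zs ∘ suc) (Fin.suc-injective ∘ distinct) (difference-quotient z p)
      (ℕ.≤-trans (ℕ.≤-reflexive (length-difference-quotient z p)) l)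
      (λ i → *-cancel-zero (λ e → Fin.0≢1+n (distinct (sym (-≈0⇒≈ e))))
        (trans (sym (trans (eval-difference-quotient z a p _) (trans (+-congʳ (roots zero)) (+-identityˡ _)))) (roots (suc i)))))
    a≈0 : a ≈ 0#
    a≈0 = trans (sym (trans (+-congˡ (trans (*-congˡ (eval-zero z p-zero)) (zeroʳ z))) (+-identityʳ a))) (roots zero)

  -- The argument compares lowest coefficients, since leading ones may be hidden behind trailing
  -- zeros of the list.
  *ₚ-integral : ∀ p q → p *ₚ q ≈ₚ [] → p ≈ₚ [] ⊎ q ≈ₚ []
  *ₚ-integral p []      e = inj₂ λ _ → refl
  *ₚ-integral p (b ∷ q) e with em {P = b ≈ 0#}
  ... | yes b≈0 = Sum.map₂ (λ q≈0 → λ { zero → b≈0 ; (suc i) → q≈0 i })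
    (*ₚ-integral p q λ i → begin
      coeff (p *ₚ q) i                              ≈⟨ +-identityˡ _ ⟨
      0# + coeff (p *ₚ q) i                         ≈⟨ +-congʳ (trans (*-congʳ b≈0) (zeroˡ _)) ⟨
      b * coeff p (suc i) + coeff (p *ₚ q) i        ≈⟨ coeff-*ₚ∷ p b q (suc i) ⟨
      coeff (p *ₚ (b ∷ q)) (suc i)                  ≈⟨ e (suc i) ⟩
      0#                                            ∎)
  ... | no b≉0 = inj₁ (lowest p e)
    where
    lowest : ∀ p → p *ₚ (b ∷ q) ≈ₚ [] → p ≈ₚ []
    lowest []      e i       = refl
    lowest (a ∷ p) e = λ { zero → a≈0 ; (suc i) → lowest p tail i }
      where
      a≈0 : a ≈ 0#
      a≈0 = *-cancel-zero b≉0 (trans (*-comm b a) (trans (sym (+-identityʳ _)) (trans (sym (coeff-∷*ₚ a p (b ∷ q) 0)) (e 0))))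
      tail : p *ₚ (b ∷ q) ≈ₚ []
      tail i = begin
        coeff (p *ₚ (b ∷ q)) i                                        ≈⟨ +-identityˡ _ ⟨
        0# + coeff (p *ₚ (b ∷ q)) i                                   ≈⟨ +-congʳ (trans (*-congʳ a≈0) (zeroˡ _)) ⟨
        a * coeff (b ∷ q) (suc i) + coeff (p *ₚ (b ∷ q)) i            ≈⟨ coeff-∷*ₚ a p (b ∷ q) (suc i) ⟨
        coeff ((a ∷ p) *ₚ (b ∷ q)) (suc i)                            ≈⟨ e (suc i) ⟩
        0#                                                            ∎

-- Partial isomorphisms as subfields of L × L, and their simple extensions.

module PartialAutomorphisms (em : ∀ {ℓ} → ExcludedMiddle ℓ) {c ℓ ℓ′} (L : HeytingField c ℓ ℓ′) where

  L×L : CommutativeRing c ℓ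
  L×L = DirectProduct.commutativeRing (fieldRing L) (fieldRing L)

  private
    module LX = Polynomial (rawField L)
    module LP = PolynomialProperties (fieldRing L)
    module P  = CommutativeRing L×L
    module PX = Polynomial P.rawRing
  open PolynomialProperties L×L
    using (IsSubfield; monic; _[_]; adjoin-isSubfield; adjoin-⊇; adjoin-∋; normalise; length-monic)
  open CommutativeRing (fieldRing L) hiding (zero)
  open ClassicalField em L
  open SetoidReasoning setoid

  diag : Carrier → Carrier × Carrier
  diag x = x , x

  proj₁-eval : ∀ p x y → proj₁ (PX.eval p (x , y)) ≡ LX.eval (map proj₁ p) x
  proj₁-eval []      x y = ≡.refl
  proj₁-eval (a ∷ p) x y = ≡.cong (λ e → proj₁ a + x * e) (proj₁-eval p x y)

  proj₂-eval : ∀ p x y → proj₂ (PX.eval p (x , y)) ≡ LX.eval (map proj₂ p) y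
  proj₂-eval []      x y = ≡.refl
  proj₂-eval (a ∷ p) x y = ≡.cong (λ e → proj₂ a + y * e) (proj₂-eval p x y)

  proj₂-coeff : ∀ p i → proj₂ (PX.coeff p i) ≡ LX.coeff (map proj₂ p) i
  proj₂-coeff []      i       = ≡.refl
  proj₂-coeff (a ∷ p) zero    = ≡.refl
  proj₂-coeff (a ∷ p) (suc i) = proj₂-coeff p i

  map-diag : ∀ (π : Carrier × Carrier → Carrier) → (∀ x → π (diag x) ≡ x) → ∀ f →
    map π (monic (map diag f)) ≡ LP.monic f
  map-diag π e []      = ≡.cong (_∷ []) (e 1#)
  map-diag π e (a ∷ f) = ≡.cong₂ _∷_ (e a) (map-diag π e f)

  module _ {s} {S : Pred (Carrier × Carrier) s} (S-subfield : IsSubfield S) where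

    open IsSubfield S-subfield

    -- A subfield of L × L contains no element (0 , y) with y nonzero, since
    -- such an element would be neither zero nor invertible.
    zero-to-zero : ∀ {x y} → S (x , y) → x ≈ 0# → y ≈ 0#
    zero-to-zero xy∈S x≈0 with inverse xy∈S
    ... | inj₁ (_ , y≈0)         = y≈0
    ... | inj₂ (_ , _ , xu≈1 , _) = ⊥-elim (unit-nonzero xu≈1 x≈0)

    zero-from-zero : ∀ {x y} → S (x , y) → y ≈ 0# → x ≈ 0#
    zero-from-zero xy∈S y≈0 with inverse xy∈S
    ... | inj₁ (x≈0 , _)         = x≈0
    ... | inj₂ (_ , _ , _ , yv≈1) = ⊥-elim (unit-nonzero yv≈1 y≈0)

    functional : ∀ {x y x′ y′} → S (x , y) → S (x′ , y′) → x ≈ x′ → y ≈ y′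
    functional p q e = -≈0⇒≈ (zero-to-zero (+-closed p (-‿closed q)) (trans (+-congʳ e) (-‿inverseʳ _)))

    injective : ∀ {x y x′ y′} → S (x , y) → S (x′ , y′) → y ≈ y′ → x ≈ x′
    injective p q e = -≈0⇒≈ (zero-from-zero (+-closed p (-‿closed q)) (trans (+-congʳ e) (-‿inverseʳ _)))

    module _ (γ : Carrier) where

      -- A list over `S` has a polynomial over the domain of the partial isomorphism as its first
      -- components and the transported polynomial as its second; only the former is tested at γ.
      AnnihilatedBy : PX.Poly → Set ℓ
      AnnihilatedBy p = LX.eval (map proj₁ p) γ ≈ 0#

      IsMinimal : PX.Poly → Set (c ⊔ ℓ ⊔ s)
      IsMinimal u = All S u × AnnihilatedBy (monic u) ×
        (∀ {v} → All S v → AnnihilatedBy (monic v) → length u ≤ length v)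

      minimal-polynomial : ∀ {u} → All S u → AnnihilatedBy (monic u) → ∃ IsMinimal
      minimal-polynomial {u} us root = <-rec
        (λ n → ∀ u → length u ≡ n → All S u → AnnihilatedBy (monic u) → ∃ IsMinimal) step _ u ≡.refl us root
        where
        step : ∀ n → (∀ {m} → m < n → ∀ u → length u ≡ m → All S u → AnnihilatedBy (monic u) → ∃ IsMinimal) →
          ∀ u → length u ≡ n → All S u → AnnihilatedBy (monic u) → ∃ IsMinimal
        step n rec u ≡.refl us root with em {P = ∃[ v ] (length v < length u × All S v × AnnihilatedBy (monic v))}
        ... | yes (v , l , vs , root′) = rec l v ≡.refl vs root′
        ... | no ¬smaller = u , us , root , λ {v} vs root′ → ℕ.≮⇒≥ λ l → ¬smaller (v , l , vs , root′)

      -- Otherwise `normalise` yields a monic annihilator of degree below `length p`, against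
      -- minimality. Normalising pairs makes both components vanish at once.
      minimal⇒zero : ∀ {u p} → IsMinimal u → All S p → length p ≤ length u → AnnihilatedBy p → All (P._≈ P.0#) p
      minimal⇒zero {u} {p} (_ , _ , minimal) ps l root with normalise S-subfield ps
      ... | inj₁ zs = zs
      ... | inj₂ (a , b , v , _ , _ , ab≈1 , vs , lv , e) = ⊥-elim (ℕ.<⇒≱ (ℕ.<-≤-trans lv l) (minimal vs root′))
        where
        root′ : AnnihilatedBy (monic v)
        root′ = *-cancel-zero (unit-nonzero (proj₁ ab≈1)) (begin
          proj₁ a * LX.eval (map proj₁ (monic v)) γ   ≡⟨ ≡.cong (proj₁ a *_) (proj₁-eval (monic v) γ γ) ⟨
          proj₁ a * proj₁ (PX.eval (monic v) (γ , γ)) ≈⟨ proj₁ (e (γ , γ)) ⟨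
          proj₁ (PX.eval p (γ , γ))                   ≡⟨ proj₁-eval p γ γ ⟩
          LX.eval (map proj₁ p) γ                     ≈⟨ root ⟩
          0#                                          ∎)

      minimal-degree : ∀ {u} → IsMinimal u → 1 ≤ length u
      minimal-degree {_ ∷ _} m = s≤s z≤n
      minimal-degree {[]} (_ , root , _) = ⊥-elim (1≉0 (trans (sym (trans (+-congˡ (zeroʳ γ)) (+-identityʳ 1#))) root))

      eval≈0 : ∀ u {γ′} → AnnihilatedBy u → LX.eval (map proj₂ u) γ′ ≈ 0# → PX.eval u (γ , γ′) P.≈ P.0#
      eval≈0 u {γ′} e e′ = trans (reflexive (proj₁-eval u γ γ′)) e , trans (reflexive (proj₂-eval u γ γ′)) e′

      -- Irreducibility is decided in the first component: if a product vanishes at (γ , γ′), then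
      -- one factor annihilates γ, since L is a field, and being short it is zero by minimality.
      extend : ∀ {u γ′} → IsMinimal u → LX.eval (map proj₂ (monic u)) γ′ ≈ 0# → IsSubfield (_[_] S-subfield (γ , γ′))
      extend {u} {γ′} m@(us , root , _) root′ = adjoin-isSubfield S-subfield (γ , γ′) (1≉0 ∘ proj₁) us (eval≈0 (monic u) root root′)
        λ {p} {q} ps qs lp lq e → Sum.map
          (λ r → minimal⇒zero m ps lp (trans (reflexive (≡.sym (proj₁-eval p γ γ′))) r))
          (λ r → minimal⇒zero m qs lq (trans (reflexive (≡.sym (proj₁-eval q γ γ′))) r))
          (integral (proj₁ e))

  AlgebraicallyClosed : Set (c ⊔ ℓ)
  AlgebraicallyClosed = ∀ p → ¬ (∃[ a ] p LX.≈ₚ LX.C a) → ∃[ x ] LX.IsRoot p x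

  monic-non-constant : ∀ u → 1 ≤ length u → ¬ (∃[ a ] map proj₂ (monic u) LX.≈ₚ LX.C a)
  monic-non-constant (b ∷ u) _ (a , e) =
    LP.monic-nonzero 1≉0 (map proj₂ u) (≡.subst (All (_≈ 0#)) (List.map-++ proj₂ u _) (LP.≈ₚ[]⇒zero _ (e ∘ suc)))

  module _ {s} {S : Pred (Carrier × Carrier) (c ⊔ ℓ ⊔ s)} where

    -- The level of `T` absorbs c and ℓ, so adjoining any number of elements never raises it.
    record Extension (S-subfield : IsSubfield S) : Set (Level.suc (c ⊔ ℓ ⊔ s)) where
      field
        T          : Pred (Carrier × Carrier) (c ⊔ ℓ ⊔ s)
        T-subfield : IsSubfield T
        extends    : S ⊆ T

  open Extension public

  -- Moving an element that lies outside the base field.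

  module Galois (closed : AlgebraicallyClosed) (f : LX.Poly) where

    IsRootᶠ : Carrier → Set ℓ
    IsRootᶠ z = LX.eval (LP.monic f) z ≈ 0#

    annihilated : ∀ {s} {S : Pred (Carrier × Carrier) s} (S-subfield : IsSubfield S) {γ} → IsRootᶠ γ →
      AnnihilatedBy S-subfield γ (monic (map diag f))
    annihilated _ {γ} root = trans (reflexive (≡.cong (λ p → LX.eval p γ) (map-diag proj₁ (λ _ → ≡.refl) f))) root

    -- Since L is algebraically closed, each transported minimal polynomial has a root to serve as
    -- the image; afterwards `T` is defined on all listed roots.
    extend-all : ∀ {s} {S : Pred (Carrier × Carrier) (c ⊔ ℓ ⊔ s)} (S-subfield : IsSubfield S) → All S (map diag f) →
      ∀ {γs} → All IsRootᶠ γs → Σ (Extension {s} S-subfield) λ E → All (λ γ → ∃[ y ] T E (γ , y)) γs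
    extend-all {s} S-subfield fs [] = record { T-subfield = S-subfield ; extends = λ x → x } , []
    extend-all {s} {S} S-subfield fs {γ ∷ γs} (r ∷ rs) =
      let u , m = minimal-polynomial S-subfield γ fs (annihilated S-subfield r)
          γ′ , root′ = closed (map proj₂ (monic u)) (monic-non-constant u (minimal-degree S-subfield γ m))
          E , images = extend-all {s} (extend S-subfield γ m root′) (All.map (adjoin-⊇ S-subfield (γ , γ′)) fs) rs
      in record { T-subfield = T-subfield E ; extends = extends E ∘ adjoin-⊇ S-subfield (γ , γ′) } ,
         (γ′ , extends E (adjoin-∋ S-subfield (γ , γ′))) ∷ images

    module _ {n} (γ : Vector Carrier n) (distinct : Distinct γ) (length-f : length f ≡ n) (roots : ∀ i → IsRootᶠ (γ i)) where

      Diagonal : ∀ {s} → Pred (Carrier × Carrier) s → Set _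
      Diagonal S = ∀ {x y} → S (x , y) → x ≈ y

      module _ {s} {S : Pred (Carrier × Carrier) s} (S-subfield : IsSubfield S) (fs : All S (map diag f))
        {γ₀} (root₀ : IsRootᶠ γ₀) {u} (m : IsMinimal S-subfield γ₀ u) where

        open IsSubfield S-subfield
        open PolynomialProperties.Division L×L isSubring

        private
          us = proj₁ m
          d = length u
          m₂ : LX.Poly
          m₂ = map proj₂ (monic u)

          length-diag-f : length (map diag f) ≡ n
          length-diag-f = ≡.trans (List.length-map diag f) length-f

          d≤n : d ≤ n
          d≤n = ℕ.≤-trans (proj₂ (proj₂ m) fs (annihilated S-subfield root₀)) (ℕ.≤-reflexive length-diag-f)

        -- If m denotes the minimal polynomial, (r - x) f / m vanishes at all n roots of f.
        constant-on-conjugates : ∀ {r x} → length r ≡ d →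
          (∀ {γ′} → LX.eval m₂ γ′ ≈ 0# → LX.eval (map proj₂ r) γ′ ≈ x) → proj₂ (PX.coeff r 0) ≈ x
        constant-on-conjugates {r} {x} length-r fixed =
          let q , remainder , _ , remainder∈S , length-q , length-remainder , f≈qm+r =
                divide-monic us (n ℕ.∸ d) fs (≡.trans length-diag-f (≡.sym (ℕ.m∸n+n≡m d≤n)))
          in conclude q remainder remainder∈S length-q length-remainder f≈qm+r
          where
          r₂ g : LX.Poly
          r₂ = map proj₂ r
          g  = r₂ LX.+ₚ LX.C (- x)

          eval-g : ∀ z → LX.eval r₂ z ≈ x → LX.eval g z ≈ 0#
          eval-g z e = trans (LP.eval-+ₚ r₂ (LX.C (- x)) z)
            (trans (+-cong e (trans (+-congˡ (zeroʳ z)) (+-identityʳ (- x)))) (-‿inverseʳ x))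

          length-g : length g ≡ d
          length-g = ≡.trans (LP.length-+ₚ r₂ (LX.C (- x))) (≡.trans (ℕ.m≥n⇒m⊔n≡m
            (≡.subst (1 ≤_) (≡.sym (≡.trans (List.length-map proj₂ r) length-r)) (minimal-degree S-subfield γ₀ m)))
            (≡.trans (List.length-map proj₂ r) length-r))

          module _ (q remainder : PX.Poly) (remainder∈S : All S remainder) (length-q : length q ≡ n ℕ.∸ d)
            (length-remainder : length remainder ≡ d) (f≈qm+r : Divides us (monic (map diag f)) (monic q) remainder) where

            q₂ : LX.Poly
            q₂ = map proj₂ (monic q)

            remainder-zero : All (P._≈ P.0#) remainder
            remainder-zero = minimal⇒zero S-subfield γ₀ m remainder∈S (ℕ.≤-reflexive length-remainder) (begin
              LX.eval (map proj₁ remainder) γ₀                  ≡⟨ proj₁-eval remainder γ₀ γ₀ ⟨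
              proj₁ (PX.eval remainder (γ₀ , γ₀))               ≈⟨ +-identityˡ _ ⟨
              0# + proj₁ (PX.eval remainder (γ₀ , γ₀))
                ≈⟨ +-congʳ (trans (*-congˡ (trans (reflexive (proj₁-eval (monic u) γ₀ γ₀)) (proj₁ (proj₂ m)))) (zeroʳ _)) ⟨
              proj₁ (PX.eval (monic q) (γ₀ , γ₀)) * proj₁ (PX.eval (monic u) (γ₀ , γ₀)) + proj₁ (PX.eval remainder (γ₀ , γ₀))
                ≈⟨ proj₁ (f≈qm+r (γ₀ , γ₀)) ⟨
              proj₁ (PX.eval (monic (map diag f)) (γ₀ , γ₀))    ≡⟨ proj₁-eval (monic (map diag f)) γ₀ γ₀ ⟩
              LX.eval (map proj₁ (monic (map diag f))) γ₀       ≈⟨ annihilated S-subfield root₀ ⟩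
              0#                                                ∎)

            qm≈0 : ∀ i → LX.eval q₂ (γ i) * LX.eval m₂ (γ i) ≈ 0#
            qm≈0 i = begin
              LX.eval q₂ (γ i) * LX.eval m₂ (γ i)
                ≡⟨ ≡.cong₂ _*_ (proj₂-eval (monic q) (γ i) (γ i)) (proj₂-eval (monic u) (γ i) (γ i)) ⟨
              proj₂ (PX.eval (monic q) (γ i , γ i)) * proj₂ (PX.eval (monic u) (γ i , γ i))
                ≈⟨ trans (+-congˡ (proj₂ (PolynomialProperties.eval-zero L×L (γ i , γ i) remainder-zero))) (+-identityʳ _) ⟨
              proj₂ (PX.eval (monic q) (γ i , γ i)) * proj₂ (PX.eval (monic u) (γ i , γ i)) + proj₂ (PX.eval remainder (γ i , γ i))
                ≈⟨ proj₂ (f≈qm+r (γ i , γ i)) ⟨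
              proj₂ (PX.eval (monic (map diag f)) (γ i , γ i))    ≡⟨ proj₂-eval (monic (map diag f)) (γ i) (γ i) ⟩
              LX.eval (map proj₂ (monic (map diag f))) (γ i)
                ≡⟨ ≡.cong (λ p → LX.eval p (γ i)) (map-diag proj₂ (λ _ → ≡.refl) f) ⟩
              LX.eval (LP.monic f) (γ i)                          ≈⟨ roots i ⟩
              0#                                                  ∎

            -- At a root of f the cofactor or the minimal polynomial vanishes; in the second case
            -- the root is a conjugate of γ₀, where r takes the value x.
            gq-roots : ∀ i → LX.eval (g LX.*ₚ q₂) (γ i) ≈ 0#
            gq-roots i = trans (LP.eval-*ₚ g q₂ (γ i)) (Sum.[
              (λ q≈0 → trans (*-congˡ q≈0) (zeroʳ _)) ,
              (λ m≈0 → trans (*-congʳ (eval-g (γ i) (fixed m≈0))) (zeroˡ _)) ]′ (integral (qm≈0 i)))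

            gq-zero : All (_≈ 0#) (g LX.*ₚ q₂)
            -- `g` has length d and `q₂` has length n - d + 1, so the product has length at most n
            -- and cannot have n distinct zeros unless it is zero.
            gq-zero = few-roots γ distinct (g LX.*ₚ q₂)
              (ℕ.≤-trans (LP.length-*ₚ g q₂ (ℕ.≤-reflexive
                (≡.trans (List.length-map proj₂ (monic q)) (≡.trans (length-monic q) (≡.cong suc length-q)))))
                (ℕ.≤-reflexive (≡.trans (≡.cong (ℕ._+ (n ℕ.∸ d)) length-g) (ℕ.m+[n∸m]≡n d≤n))))
              gq-roots

            g-zero : g LX.≈ₚ []
            g-zero = Sum.[ (λ e → e) , (λ e → ⊥-elim (LP.monic-nonzero 1≉0 (map proj₂ q)
              (≡.subst (All (_≈ 0#)) (List.map-++ proj₂ q (P.1# ∷ [])) (LP.≈ₚ[]⇒zero _ e)))) ]′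
              (*ₚ-integral g q₂ (LP.coeff-zero gq-zero))

            conclude : proj₂ (PX.coeff r 0) ≈ x
            conclude = -≈0⇒≈ (trans (+-congʳ (reflexive (proj₂-coeff r 0))) (trans (sym (LP.coeff-+ₚ r₂ (LX.C (- x)) 0)) (g-zero 0)))

        Moved : Carrier → Set _
        Moved x = ∃[ γ′ ] (IsSubfield (_[_] S-subfield (γ₀ , γ′)) × (∃[ y ] (_[_] S-subfield (γ₀ , γ′) (x , y) × ¬ y ≈ x)))

        -- Write x = p (γ₀) and reduce p modulo the minimal polynomial. If every conjugate keeps x
        -- in place, the remainder takes the value x at all conjugates, hence its constant
        -- coefficient is x; but that coefficient lies in `S`.
        move : Diagonal S → ∀ {x} → _[_] S-subfield (γ₀ , γ₀) (x , x) → ¬ S (x , x) → Moved x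
        move diagonal {x} (p , ps , x≈p) x∉S with em {P = Moved x}
        ... | yes moved = moved
        ... | no ¬moved =
          let q , r , rs , length-r , p≈qm+r = divide us ps
              x≈r₀ = constant-on-conjugates {r} length-r (fixed q r p≈qm+r)
          in ⊥-elim (x∉S (≈-closed (trans (diagonal (coeff-closed rs 0)) x≈r₀ , x≈r₀) (coeff-closed rs 0)))
          where
          module _ (q r : PX.Poly) (p≈qm+r : Divides us p q r) where

            p≈r : ∀ {γ′} → LX.eval m₂ γ′ ≈ 0# → PX.eval p (γ₀ , γ′) P.≈ PX.eval r (γ₀ , γ′)
            p≈r {γ′} root′ = P.trans (p≈qm+r (γ₀ , γ′))
              (P.trans (P.+-congʳ
                (P.trans (P.*-congˡ (eval≈0 S-subfield γ₀ (monic u) (proj₁ (proj₂ m)) root′)) (P.zeroʳ _))) (P.+-identityˡ _))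

            fixed : ∀ {γ′} → LX.eval m₂ γ′ ≈ 0# → LX.eval (map proj₂ r) γ′ ≈ x
            fixed {γ′} root′ with em {P = LX.eval (map proj₂ r) γ′ ≈ x}
            ... | yes e = e
            ... | no ¬e = ⊥-elim (¬moved (γ′ , extend S-subfield γ₀ m root′ , LX.eval (map proj₂ r) γ′ , (p , ps , x≈p₁ , r₂≈p₂) , ¬e))
              where
              x≈p₁ = trans (proj₁ x≈p) (reflexive (≡.trans (proj₁-eval p γ₀ γ₀) (≡.sym (proj₁-eval p γ₀ γ′))))
              r₂≈p₂ = trans (reflexive (≡.sym (proj₂-eval r γ₀ γ′))) (sym (proj₂ (p≈r root′)))

      -- This says that x lies in the field generated over `S` by the listed roots without naming
      -- that field; it passes to the remaining roots when the first is adjoined to `S`.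
      Generates : ∀ {s} {S : Pred (Carrier × Carrier) (c ⊔ ℓ ⊔ s)} → IsSubfield S → List Carrier → Carrier → Set _
      Generates {s} S-subfield γs x = (E : Extension {s} S-subfield) → Diagonal (T E) → All (λ γ → T E (γ , γ)) γs → T E (x , x)

      -- Roots are adjoined as fixed points until x enters the domain. At that root `move` chooses
      -- another conjugate as image, and `extend-all` treats the roots that are left.
      moves : ∀ {s} {S : Pred (Carrier × Carrier) (c ⊔ ℓ ⊔ s)} (S-subfield : IsSubfield S) → Diagonal S → All S (map diag f) →
        ∀ {γs} → All IsRootᶠ γs → ∀ {x} → Generates {s} S-subfield γs x → ¬ S (x , x) →
        Σ (Extension {s} S-subfield) λ E → All (λ γ → ∃[ y ] T E (γ , y)) γs × (∃[ y ] (T E (x , y) × ¬ y ≈ x))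
      moves S-subfield diagonal fs [] generates x∉S =
        ⊥-elim (x∉S (generates (record { T-subfield = S-subfield ; extends = λ x → x }) diagonal []))
      moves {s} {S} S-subfield diagonal fs {γ₀ ∷ γs} (r ∷ rs) {x} generates x∉S with em {P = _[_] S-subfield (γ₀ , γ₀) (x , x)}
      ... | yes x∈S′ =
        let _ , m = minimal-polynomial S-subfield γ₀ fs (annihilated S-subfield r)
            γ′ , S′-subfield , y , xy∈S′ , y≉x = move S-subfield fs r m diagonal x∈S′ x∉S
            ζ = γ₀ , γ′
            E , images = extend-all {s} S′-subfield (All.map (adjoin-⊇ S-subfield ζ) fs) rs
        in record { T-subfield = T-subfield E ; extends = extends E ∘ adjoin-⊇ S-subfield ζ } ,
           (γ′ , extends E (adjoin-∋ S-subfield ζ)) ∷ images , y , extends E xy∈S′ , y≉x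
      ... | no x∉S′ =
        let ζ = γ₀ , γ₀
            u , m = minimal-polynomial S-subfield γ₀ fs (annihilated S-subfield r)
            -- As `S` is diagonal, the transported minimal polynomial agrees with the original one,
            -- so γ₀ may be its own image.
            root′ = trans (reflexive (≡.sym (proj₂-eval (monic u) γ₀ γ₀)))
              (trans (sym (diagonal-eval (IsSubfield.monic-closed S-subfield (proj₁ m))))
                (trans (reflexive (proj₁-eval (monic u) γ₀ γ₀)) (proj₁ (proj₂ m))))
            S′-subfield = extend S-subfield γ₀ m root′
            E , images , moved = moves {s} S′-subfield diagonal′ (All.map (adjoin-⊇ S-subfield ζ) fs) rs
              (λ E diag-E γs∈E → generates
                (record { T-subfield = T-subfield E ; extends = extends E ∘ adjoin-⊇ S-subfield ζ }) diag-E
                (extends E (adjoin-∋ S-subfield ζ) ∷ γs∈E)) x∉S′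
        in record { T-subfield = T-subfield E ; extends = extends E ∘ adjoin-⊇ S-subfield ζ } ,
           (γ₀ , extends E (adjoin-∋ S-subfield ζ)) ∷ images , moved
        where
        diagonal-eval : ∀ {p} → All S p → proj₁ (PX.eval p (γ₀ , γ₀)) ≈ proj₂ (PX.eval p (γ₀ , γ₀))
        diagonal-eval []       = refl
        diagonal-eval (a ∷ ps) = +-cong (diagonal a) (*-congˡ (diagonal-eval ps))

        diagonal′ : Diagonal (_[_] S-subfield (γ₀ , γ₀))
        diagonal′ (p , ps , x≈p , y≈p) = trans x≈p (trans (diagonal-eval ps) (sym y≈p))

-- Products of linear factors and multiple roots.

module LinearFactors {c ℓ} (R : CommutativeRing c ℓ) where

  open CommutativeRing R hiding (zero)
  open Polynomial rawRing
  open PolynomialProperties R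
  open RawSemiringDefs (RawRing.rawSemiring rawRing) using (_^_; sum)
  open SetoidReasoning setoid
  open RingSolver R

  linearProduct : List Carrier → Poly
  linearProduct zs = listProductₚ (map X-_ zs)

  productₚ-tabulate : ∀ {n} (α : Vector Carrier n) → productₚ (λ i → X- (α i)) ≡ linearProduct (tabulate α)
  productₚ-tabulate {zero}  α = ≡.refl
  productₚ-tabulate {suc n} α = ≡.cong (X- (α zero) *ₚ_) (productₚ-tabulate (α ∘ suc))

  eval-linearProduct : ∀ {zs x} → Any (x ≈_) zs → eval (linearProduct zs) x ≈ 0#
  eval-linearProduct {z ∷ zs} {x} (here x≈z) = trans (eval-*ₚ (X- z) (linearProduct zs) x)
    (trans (*-congʳ (trans (eval-X- z x) (trans (+-congʳ x≈z) (-‿inverseʳ z)))) (zeroˡ _))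
  eval-linearProduct {z ∷ zs} {x} (there i) = trans (eval-*ₚ (X- z) (linearProduct zs) x)
    (trans (*-congˡ (eval-linearProduct i)) (zeroʳ _))

  -- Stated by coefficients, because a list may carry zeros above its leading coefficient.
  record IsMonic (n : ℕ) (p : Poly) : Set ℓ where
    field
      leading : coeff p n ≈ 1#
      above   : ∀ {i} → n < i → coeff p i ≈ 0#

  linearProduct-monic : ∀ zs → IsMonic (length zs) (linearProduct zs)
  linearProduct-monic []       = record { leading = refl ; above = λ { (s≤s _) → refl } }
  linearProduct-monic (z ∷ zs) = record
    { leading = trans (expand n) (trans (+-cong (trans (*-congˡ (above ℕ.≤-refl)) (zeroʳ _)) leading) (+-identityˡ 1#))
    ; above   = λ { {suc i} (s≤s l) → trans (expand i)
        (trans (+-cong (trans (*-congˡ (above (ℕ.m≤n⇒m≤1+n l))) (zeroʳ _)) (above l)) (+-identityˡ 0#)) }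
    }
    where
    open IsMonic (linearProduct-monic zs)
    n = length zs
    q = linearProduct zs
    expand : ∀ i → coeff (X- z *ₚ q) (suc i) ≈ (0# + - z) * coeff q (suc i) + coeff q i
    expand i = trans (coeff-∷*ₚ (0# + - z) (C 1#) q (suc i)) (+-congˡ (trans (*ₚ-comm (C 1#) q i) (*ₚ-identityʳ q i)))

  IsMonic-resp : ∀ {n p q} → p ≈ₚ q → IsMonic n q → IsMonic n p
  IsMonic-resp e m = record { leading = trans (e _) leading ; above = λ l → trans (e _) (above l) }
    where open IsMonic m

  lower-coefficients : ℕ → Poly → Poly
  lower-coefficients n p = applyUpTo (coeff p) n

  monic-lower-coefficients : ∀ {n p} → IsMonic n p → monic (lower-coefficients n p) ≈ₚ p
  monic-lower-coefficients {n} {p} m = truncate n (coeff p) leading above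
    where
    open IsMonic m
    truncate : ∀ n h → h n ≈ 1# → (∀ {i} → n < i → h i ≈ 0#) → ∀ i → coeff (monic (applyUpTo h n)) i ≈ h i
    truncate zero    h h≈1 h≈0 zero    = sym h≈1
    truncate zero    h h≈1 h≈0 (suc i) = sym (h≈0 (s≤s z≤n))
    truncate (suc n) h h≈1 h≈0 zero    = refl
    truncate (suc n) h h≈1 h≈0 (suc i) = truncate n (h ∘ suc) h≈1 (λ l → h≈0 (s≤s l)) i

  linear-factor : ∀ {z zs} → z ∈ zs → ∃[ q ] q *ₚ (X- z) ≈ₚ linearProduct zs
  linear-factor {zs = z ∷ zs} (here ≡.refl) = linearProduct zs , *ₚ-comm (linearProduct zs) (X- z)
  linear-factor {z} {y ∷ zs}  (there z∈zs)  =
    let q , e = linear-factor z∈zs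
    in (X- y) *ₚ q , λ i → trans (*ₚ-assoc (X- y) q (X- z) i) (*ₚ-congˡ (X- y) {q *ₚ (X- z)} {linearProduct zs} e i)

  X--cong : ∀ {y z} → y ≈ z → (X- y) ≈ₚ (X- z)
  X--cong e zero    = +-congˡ (-‿cong e)
  X--cong e (suc i) = refl

  -- If y ≈ z for two entries, then (X - y)(X - z) is the square of X - y and divides the product; a
  -- square dividing the tail divides the whole product as well.
  noMultipleRoot-distinct : ∀ zs → NoMultipleRoot (linearProduct zs) → AllPairs (λ y z → ¬ y ≈ z) zs
  noMultipleRoot-distinct []       simple = []
  noMultipleRoot-distinct (y ∷ zs) simple =
    All.tabulate (λ {z} z∈zs y≈z → let q , e = linear-factor z∈zs in
      simple y (record { quotient = q ; equality = λ i → begin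
        coeff (q *ₚ ((X- y) *ₚ ((X- y) *ₚ C 1#))) i
          ≈⟨ *ₚ-congˡ q {(X- y) *ₚ ((X- y) *ₚ C 1#)} {(X- y) *ₚ (X- y)}
               (*ₚ-congˡ (X- y) {(X- y) *ₚ C 1#} {X- y} (*ₚ-identityʳ (X- y))) i ⟩
        coeff (q *ₚ ((X- y) *ₚ (X- y))) i           ≈⟨ *ₚ-assoc q (X- y) (X- y) i ⟨
        coeff ((q *ₚ (X- y)) *ₚ (X- y)) i
          ≈⟨ *ₚ-congʳ {q *ₚ (X- y)} {q *ₚ (X- z)} (X- y) (*ₚ-congˡ q {X- y} {X- z} (X--cong y≈z)) i ⟩
        coeff ((q *ₚ (X- z)) *ₚ (X- y)) i           ≈⟨ *ₚ-congʳ {q *ₚ (X- z)} {linearProduct zs} (X- y) e i ⟩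
        coeff (linearProduct zs *ₚ (X- y)) i        ≈⟨ *ₚ-comm (linearProduct zs) (X- y) i ⟩
        coeff ((X- y) *ₚ linearProduct zs) i        ∎ }))
    ∷ noMultipleRoot-distinct zs λ x (record { quotient = q ; equality = e }) →
      simple x (record { quotient = (X- y) *ₚ q ; equality = λ i →
        trans (*ₚ-assoc (X- y) q ((X- x) ^ₚ 2) i) (*ₚ-congˡ (X- y) {q *ₚ (X- x) ^ₚ 2} {linearProduct zs} e i) })

  NoMultipleRoot-resp : ∀ {p q} → p ≈ₚ q → NoMultipleRoot p → NoMultipleRoot q
  NoMultipleRoot-resp e simple x (record { quotient = r ; equality = e′ }) =
    simple x (record { quotient = r ; equality = λ i → trans (e′ i) (sym (e i)) })

  eval-tabulate : ∀ {n} (a : Vector Carrier n) x → eval (tabulate a) x ≈ sum (λ l → a l * x ^ toℕ l)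
  eval-tabulate {zero}  a x = refl
  eval-tabulate {suc n} a x = +-cong (sym (*-identityʳ _)) (trans (*-congˡ (eval-tabulate (a ∘ suc) x)) (shift (a ∘ suc) toℕ))
    where
    -- The exponents are an arbitrary function because the tail of the sum no longer has exponents
    -- `toℕ`.
    shift : ∀ {m} (b : Vector Carrier m) (e : Fin m → ℕ) → x * sum (λ l → b l * x ^ e l) ≈ sum (λ l → b l * x ^ suc (e l))
    shift {zero}  b e = zeroʳ x
    shift {suc m} b e = trans (distribˡ x _ _)
      (+-cong (solve 3 (λ x b y → x :* (b :* y) := b :* (x :* y)) refl x _ _) (shift (b ∘ suc) (e ∘ suc)))

  coeff-tabulate : ∀ {n} (a : Vector Carrier n) l → coeff (tabulate a) (toℕ l) ≡ a l
  coeff-tabulate a zero    = ≡.refl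
  coeff-tabulate a (suc l) = coeff-tabulate (a ∘ suc) l

-- Pairwise distinct lists and permutations of a finite set.

AllPairs-lookup : ∀ {a ℓ} {A : Set a} {R : A → A → Set ℓ} {xs} → AllPairs R xs →
  ∀ {x y} → x ∈ xs → y ∈ xs → x ≡ y ⊎ R x y ⊎ R y x
AllPairs-lookup (r ∷ rs) (here ≡.refl) (here ≡.refl) = inj₁ ≡.refl
AllPairs-lookup (r ∷ rs) (here ≡.refl) (there y∈xs)  = inj₂ (inj₁ (All.lookup r y∈xs))
AllPairs-lookup (r ∷ rs) (there x∈xs)  (here ≡.refl) = inj₂ (inj₂ (All.lookup r x∈xs))
AllPairs-lookup (r ∷ rs) (there x∈xs)  (there y∈xs)  = AllPairs-lookup rs x∈xs y∈xs

AllPairs-tabulate : ∀ {a ℓ} {A : Set a} {R : A → A → Set ℓ} {n} {f : Fin n → A} → AllPairs R (tabulate f) →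
  ∀ i j → i ≡ j ⊎ R (f i) (f j) ⊎ R (f j) (f i)
AllPairs-tabulate (r ∷ rs) zero    zero    = inj₁ ≡.refl
AllPairs-tabulate (r ∷ rs) zero    (suc j) = inj₂ (inj₁ (All.tabulate⁻ r j))
AllPairs-tabulate (r ∷ rs) (suc i) zero    = inj₂ (inj₂ (All.tabulate⁻ r i))
AllPairs-tabulate (r ∷ rs) (suc i) (suc j) = Sum.map₁ (≡.cong suc) (AllPairs-tabulate rs i j)

∈-allPermutations : ∀ {n} (π : Permutation′ n) → Any (π Perm.≈_) (allPermutations n)
∈-allPermutations {zero}  π = here λ ()
∈-allPermutations {suc n} π = Any.concatMap⁺ (λ i → map (Perm.insert zero i) (allPermutations n)) {xs = allFin (suc n)}
  (lose (∈-allFin (π ⟨$⟩ʳ zero)) (Any.map⁺ (Any.map insert-≈ (∈-allPermutations (Perm.remove zero π)))))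
  where
  insert-≈ : ∀ {ρ} → Perm.remove zero π Perm.≈ ρ → π Perm.≈ Perm.insert zero (π ⟨$⟩ʳ zero) ρ
  insert-≈ e zero    = ≡.refl
  insert-≈ {ρ} e (suc k) = ≡.trans (Perm.punchIn-permute π zero k)
    (≡.trans (≡.cong (punchIn (π ⟨$⟩ʳ zero)) (e k)) (≡.sym (Perm.insert-punchIn zero (π ⟨$⟩ʳ zero) ρ k)))

-- Pigeonhole: if f missed y, putting y in front of the values of f would inject `Fin (suc n)` into
-- `Fin n`.
injective⇒permutation : ∀ {n} (f : Fin n → Fin n) → (∀ {i j} → f i ≡ f j → i ≡ j) →
  ∃[ π ] ∀ i → π ⟨$⟩ʳ i ≡ f i
injective⇒permutation {n} f injective = permutation f g fg gf , λ _ → ≡.refl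
  where
  surjective : ∀ y → ∃[ x ] f x ≡ y
  surjective y with Fin.any? (λ x → f x Fin.≟ y)
  ... | yes p = p
  ... | no ¬p = ⊥-elim (ℕ.1+n≰n (Fin.injective⇒≤ {f = f′} f′-injective))
    where
    f′ : Fin (suc n) → Fin n
    f′ zero    = y
    f′ (suc i) = f i
    f′-injective : ∀ {i j} → f′ i ≡ f′ j → i ≡ j
    f′-injective {zero}  {zero}  e = ≡.refl
    f′-injective {zero}  {suc j} e = ⊥-elim (¬p (j , ≡.sym e))
    f′-injective {suc i} {zero}  e = ⊥-elim (¬p (i , e))
    f′-injective {suc i} {suc j} e = ≡.cong suc (injective e)
  g = proj₁ ∘ surjective
  fg : ∀ y → f (g y) ≡ y
  fg = proj₂ ∘ surjective
  gf : ∀ x → g (f x) ≡ x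
  gf x = injective (fg (f x))

-- Transitive actions and conjugate stabilisers.

module _ {c ℓ} (Γ : Group c ℓ) where

  open Group Γ
  open GroupProperties Γ

  record TransitiveAction (n : ℕ) : Set (c ⊔ ℓ) where
    field
      act      : Carrier → Fin n → Fin n
      act-cong : ∀ {x y} → x ≈ y → ∀ i → act x i ≡ act y i
      act-ε    : ∀ i → act ε i ≡ i
      act-∙    : ∀ x y i → act (x ∙ y) i ≡ act x (act y i)
      reach    : ∀ i j → ∃[ x ] act x i ≡ j

    act-⁻¹ : ∀ {x i j} → act x i ≡ j → act (x ⁻¹) j ≡ i
    act-⁻¹ {x} {i} ≡.refl = ≡.trans (≡.sym (act-∙ (x ⁻¹) x i)) (≡.trans (act-cong (inverseˡ x) i) (act-ε i))

    act-⁻¹-∙ : ∀ {x y i j} → act (x ⁻¹ ∙ y) i ≡ j → act y i ≡ act x j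
    act-⁻¹-∙ {x} {y} {i} {j} e = ≡.trans (≡.sym (act-cong (\\-leftDividesˡ x y) i)) (≡.trans (act-∙ x (x ⁻¹ ∙ y) i) (≡.cong (act x) e))

    -- Lifted to an arbitrary level, to match the subgroups over which `AllIndexConjugate`
    -- quantifies.
    stabilizer : ∀ h → Fin n → Subgroup Γ h
    stabilizer h i = record
      { member    = λ x → Lift h (act x i ≡ i)
      ; ∈-resp    = λ x≈y (lift e) → lift (≡.trans (≡.sym (act-cong x≈y i)) e)
      ; ε-closed  = lift (act-ε i)
      ; ∙-closed  = λ {x} {y} (lift e) (lift e′) → lift (≡.trans (act-∙ x y i) (≡.trans (≡.cong (act x) e′) e))
      ; ⁻¹-closed = λ (lift e) → lift (act-⁻¹ e)
      }

    -- Orbit-stabiliser: j corresponds to the coset of the elements that send i to j.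
    stabilizer-index : ∀ h i → HasIndex (stabilizer h i) n
    stabilizer-index h i = record
      { to        = λ j → proj₁ (reach i j)
      ; cong      = λ { {j} ≡.refl → Setoid.refl (leftCosets (stabilizer h i)) }
      ; bijective =
          (λ {j} {k} (lift e) → ≡.trans (≡.sym (proj₂ (reach i j))) (≡.trans (≡.sym (act-⁻¹-∙ e)) (proj₂ (reach i k)))) ,
          λ x → act x i , λ { ≡.refl → lift (≡.trans (act-∙ _ x i) (act-⁻¹ (proj₂ (reach i (act x i))))) }
      }

  open TransitiveAction

  -- If g conjugates the stabiliser of zero in `A` to that in `B`, then x fixes zero in `A` exactly
  -- when it fixes m = g⁻¹ · zero in `B`. With these equal point stabilisers, sending x · zero to x
  -- · m is a well-defined bijection.
  equivariant-bijection : ∀ {h n} → AllIndexConjugate Γ h (suc n) → (A B : TransitiveAction (suc n)) →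
    ∃[ τ ] ∀ x i → act B x (τ ⟨$⟩ʳ i) ≡ τ ⟨$⟩ʳ (act A x i)
  equivariant-bijection {h} {n} conjugate A B = permutation τ τ⁻¹ τ-τ⁻¹ τ⁻¹-τ , equivariant
    where
    conj = conjugate (stabilizer A h zero) (stabilizer B h zero) (stabilizer-index A h zero) (stabilizer-index B h zero)
    g = proj₁ conj
    m = act B (g ⁻¹) zero

    fixes⇒ : ∀ {x} → act A x zero ≡ zero → act B x m ≡ m
    fixes⇒ {x} e = ≡.sym (act-⁻¹ B (≡.trans (≡.sym (act-∙ B g x m)) (≡.trans (≡.sym (act-∙ B (g ∙ x) (g ⁻¹) zero))
      (lower (Equivalence.to (proj₂ conj x) (lift e))))))

    fixes⇐ : ∀ {x} → act B x m ≡ m → act A x zero ≡ zero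
    fixes⇐ {x} e = lower (Equivalence.from (proj₂ conj x) (lift (≡.trans (act-∙ B (g ∙ x) (g ⁻¹) zero)
      (≡.trans (act-∙ B g x m) (≡.trans (≡.cong (act B g) e)
        (≡.trans (≡.sym (act-∙ B g (g ⁻¹) zero)) (≡.trans (act-cong B (inverseʳ g) zero) (act-ε B zero))))))))

    same⇒ : ∀ {x y} → act A x zero ≡ act A y zero → act B x m ≡ act B y m
    same⇒ {x} {y} e = act-⁻¹-∙ B (fixes⇒ (≡.trans (act-∙ A (y ⁻¹) x zero) (act-⁻¹ A (≡.sym e))))

    same⇐ : ∀ {x y} → act B x m ≡ act B y m → act A x zero ≡ act A y zero
    same⇐ {x} {y} e = act-⁻¹-∙ A (fixes⇐ (≡.trans (act-∙ B (y ⁻¹) x m) (act-⁻¹ B (≡.sym e))))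

    τ τ⁻¹ : Fin (suc n) → Fin (suc n)
    τ i   = act B (proj₁ (reach A zero i)) m
    τ⁻¹ j = act A (proj₁ (reach B m j)) zero

    τ-τ⁻¹ : ∀ j → τ (τ⁻¹ j) ≡ j
    τ-τ⁻¹ j = ≡.trans (same⇒ (proj₂ (reach A zero (τ⁻¹ j)))) (proj₂ (reach B m j))

    τ⁻¹-τ : ∀ i → τ⁻¹ (τ i) ≡ i
    τ⁻¹-τ i = ≡.trans (same⇐ (proj₂ (reach B m (τ i)))) (proj₂ (reach A zero i))

    equivariant : ∀ x i → act B x (τ i) ≡ τ (act A x i)
    equivariant x i = ≡.trans (≡.sym (act-∙ B x _ m)) (same⇒ (≡.trans (act-∙ A x _ zero)
      (≡.trans (≡.cong (act A x) (proj₂ (reach A zero i))) (≡.sym (proj₂ (reach A zero (act A x i)))))))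

module _ {c₁ ℓ₁ c₂ ℓ₂} {Γ : Group c₁ ℓ₁} {Δ : Group c₂ ℓ₂} (iso : GroupIsomorphic Γ Δ) where

  private
    module Γ = Group Γ
    module Δ = Group Δ
    θ = proj₁ iso
  open GroupMorphisms.IsGroupIsomorphism (proj₂ iso) using (injective; surjective; ∙-homo; ε-homo)
  open TransitiveAction

  private
    θ⁻¹ : Δ.Carrier → Γ.Carrier
    θ⁻¹ y = proj₁ (surjective y)

    θ-θ⁻¹ : ∀ y → θ (θ⁻¹ y) Δ.≈ y
    θ-θ⁻¹ y = proj₂ (surjective y) Γ.refl

    θ⁻¹-unique : ∀ {x y} → θ x Δ.≈ y → θ⁻¹ y Γ.≈ x
    θ⁻¹-unique e = injective (Δ.trans (θ-θ⁻¹ _) (Δ.sym e))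

  -- Carrying actions across the isomorphism, rather than subgroups, lets the stabilisers be formed
  -- directly in the group where conjugacy is assumed.
  transport-action : ∀ {n} → TransitiveAction Γ n → TransitiveAction Δ n
  transport-action A = record
    { act      = act A ∘ θ⁻¹
    ; act-cong = λ e → act-cong A (θ⁻¹-unique (Δ.trans (θ-θ⁻¹ _) (Δ.sym e)))
    ; act-ε    = λ i → ≡.trans (act-cong A (θ⁻¹-unique ε-homo) i) (act-ε A i)
    ; act-∙    = λ x y i → ≡.trans
        (act-cong A (θ⁻¹-unique (Δ.trans (∙-homo _ _) (Δ.∙-cong (θ-θ⁻¹ x) (θ-θ⁻¹ y)))) i) (act-∙ A _ _ i)
    ; reach    = λ i j → let x , e = reach A i j in
        θ x , ≡.trans (act-cong A (θ⁻¹-unique Δ.refl) i) e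
    }

  equivariant-bijection-≅ : ∀ {h n} → AllIndexConjugate Δ h (suc n) → (A B : TransitiveAction Γ (suc n)) →
    ∃[ τ ] ∀ x i → act B x (τ ⟨$⟩ʳ i) ≡ τ ⟨$⟩ʳ (act A x i)
  equivariant-bijection-≅ conjugate A B =
    let τ , e = equivariant-bijection Δ conjugate (transport-action A) (transport-action B) in
    τ , λ x i → ≡.trans (act-cong B (Γ.sym (θ⁻¹-unique Δ.refl)) _)
      (≡.trans (e (θ x) i) (≡.cong (τ ⟨$⟩ʳ_) (act-cong A (θ⁻¹-unique Δ.refl) i)))

-- Splitting fields inside the algebraic closure.

module SplittingFields (em : ∀ {ℓ} → ExcludedMiddle ℓ) {m₀ m₁ m₂ c ℓ ℓ′}
  (M : HeytingField m₀ m₁ m₂) (L : HeytingField c ℓ ℓ′)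
  (ι : HeytingField.Carrier M → HeytingField.Carrier L) (closure : IsAlgebraicClosure M L ι) where

  open IsAlgebraicClosure closure renaming (isFieldEmbedding to ι-emb)
  private
    module M  = CommutativeRing (fieldRing M)
    module MX = Polynomial (rawField M)
    module ι  = RingMorphisms.IsRingMonomorphism ι-emb
    level = m₀ ⊔ c ⊔ ℓ
  open CommutativeRing (fieldRing L) hiding (zero)
  open Polynomial rawRing
  open PolynomialProperties (fieldRing L)
  open LinearFactors (fieldRing L)
  open ClassicalField em L
  open PartialAutomorphisms em L
  private
    module PP = PolynomialProperties L×L

  adjoin-isSubfield-L : ∀ {h} (S : Pred Carrier h) → IsSubfield (Adjoin M L ι S)
  adjoin-isSubfield-L S = record
    { isSubring = record
      { ≈-closed = resp
      ; 1-closed = resp ι.1#-homo (base M.1#)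
      ; +-closed = add
      ; *-closed = mul
      ; -‿closed = neg
      }
    ; inverse = zero-or-unit
    }
    where
    zero-or-unit : ∀ {x} → Adjoin M L ι S x → x ≈ 0# ⊎ (∃[ y ] (Adjoin M L ι S y × x * y ≈ 1#))
    zero-or-unit {x} x∈ with em {P = x ≈ 0#}
    ... | yes x≈0 = inj₁ x≈0
    ... | no x≉0  = let y , xy≈1 = invertible x≉0 in inj₂ (y , inv xy≈1 x∈ , xy≈1)

  -- Lifted to the level of `Spl`, so that `moves-γ` applies both to M and to a splitting field.
  Image : Pred Carrier level
  Image x = Lift level (∃[ a ] ι a ≈ x)

  image-isSubfield : IsSubfield Image
  image-isSubfield = record
    { isSubring = record
      { ≈-closed = λ e (lift (a , e′)) → lift (a , trans e′ e)
      ; 1-closed = lift (M.1# , ι.1#-homo)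
      ; +-closed = λ (lift (a , e)) (lift (b , e′)) → lift (a M.+ b , trans (ι.+-homo a b) (+-cong e e′))
      ; *-closed = λ (lift (a , e)) (lift (b , e′)) → lift (a M.* b , trans (ι.*-homo a b) (*-cong e e′))
      ; -‿closed = λ (lift (a , e)) → lift (M.- a , trans (ι.-‿homo a) (-‿cong e))
      }
    ; inverse = zero-or-unit
    }
    where
    zero-or-unit : ∀ {x} → Image x → x ≈ 0# ⊎ (∃[ y ] (Image y × x * y ≈ 1#))
    zero-or-unit {x} (lift (a , e)) with em {P = a M.≈ M.0#}
    ... | yes a≈0 = inj₁ (trans (sym e) (trans (ι.⟦⟧-cong a≈0) ι.0#-homo))
    ... | no a≉0  = let b , ab≈1 = ClassicalField.invertible em M a≉0 in
      inj₂ (ι b , lift (b , refl) , trans (*-congʳ (sym e)) (trans (sym (ι.*-homo a b)) (trans (ι.⟦⟧-cong ab≈1) ι.1#-homo)))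

  IdentityOn : ∀ {s} → Pred Carrier s → Pred (Carrier × Carrier) (ℓ ⊔ s)
  IdentityOn K (x , y) = K x × x ≈ y

  identity-isSubfield : ∀ {s} {K : Pred Carrier s} → IsSubfield K → PP.IsSubfield (IdentityOn K)
  identity-isSubfield K-subfield = record
    { isSubring = record
      { ≈-closed = λ (e , e′) (x∈K , x≈y) → ≈-closed e x∈K , trans (sym e) (trans x≈y e′)
      ; 1-closed = 1-closed , refl
      ; +-closed = λ (x∈K , e) (y∈K , e′) → +-closed x∈K y∈K , +-cong e e′
      ; *-closed = λ (x∈K , e) (y∈K , e′) → *-closed x∈K y∈K , *-cong e e′
      ; -‿closed = λ (x∈K , e) → -‿closed x∈K , -‿cong e
      }
    ; inverse = λ (x∈K , x≈y) → Sum.map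
        (λ x≈0 → x≈0 , trans (sym x≈y) x≈0)
        (λ (z , z∈K , xz≈1) → (z , z) , (z∈K , refl) , (xz≈1 , trans (*-congʳ (sym x≈y)) xz≈1))
        (inverse x∈K)
    }
    where open IsSubfield K-subfield

  FixesBase : ∀ {s} → Pred (Carrier × Carrier) s → Set _
  FixesBase T = ∀ a → T (diag (ι a))

  module _ {t} {T : Pred (Carrier × Carrier) t} (T-subfield : PP.IsSubfield T) (fixes : FixesBase T) where

    open PP.IsSubfield T-subfield

    inverse-image : ∀ {h} {S : Pred Carrier h} {x y z} → x * z ≈ 1# → T (x , y) → Adjoin M L ι S y →
      ∃[ v ] (T (z , v) × Adjoin M L ι S v)
    inverse-image {x = x} {z = z} xz≈1 xy∈T q with inverse xy∈T
    ... | inj₁ (x≈0 , _) = ⊥-elim (unit-nonzero xz≈1 x≈0)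
    ... | inj₂ ((u , v) , uv∈T , xu≈1 , yv≈1) = v , ≈-closed (u≈z , refl) uv∈T , inv yv≈1 q
      where
      u≈z : u ≈ z
      u≈z = -≈0⇒≈ (*-cancel-zero (unit-nonzero xz≈1) (trans (RingProperties.x[y-z]≈xy-xz ring x u z)
        (trans (+-cong xu≈1 (-‿cong xz≈1)) (-‿inverseʳ 1#))))

    -- By induction on the derivation of membership, a graph defined on the generators is defined on
    -- the field they generate. Keeping the image in that field is what allows a restriction to an
    -- automorphism.
    adjoin-image : ∀ {h} {S : Pred Carrier h} → (∀ {x} → S x → ∃[ y ] (T (x , y) × Adjoin M L ι S y)) →
      ∀ {x} → Adjoin M L ι S x → ∃[ y ] (T (x , y) × Adjoin M L ι S y)
    adjoin-image g (base a)   = ι a , fixes a , base a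
    adjoin-image g (gen x∈S)  = g x∈S
    adjoin-image g (resp e p) = let y , xy∈T , q = adjoin-image g p in y , ≈-closed (e , refl) xy∈T , q
    adjoin-image g (add p p′) =
      let y , xy∈T , q = adjoin-image g p ; y′ , xy∈T′ , q′ = adjoin-image g p′ in y + y′ , +-closed xy∈T xy∈T′ , add q q′
    adjoin-image g (mul p p′) =
      let y , xy∈T , q = adjoin-image g p ; y′ , xy∈T′ , q′ = adjoin-image g p′ in y * y′ , *-closed xy∈T xy∈T′ , mul q q′
    adjoin-image g (neg p)    = let y , xy∈T , q = adjoin-image g p in - y , -‿closed xy∈T , neg q
    adjoin-image g (inv xz≈1 p) = let y , xy∈T , q = adjoin-image g p in inverse-image xz≈1 xy∈T q

  eval-linearProduct⁻ : ∀ zs {x} → eval (linearProduct zs) x ≈ 0# → Any (x ≈_) zs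
  eval-linearProduct⁻ []       {x} e = ⊥-elim (1≉0 (trans (sym (trans (+-congˡ (zeroʳ x)) (+-identityʳ 1#))) e))
  eval-linearProduct⁻ (z ∷ zs) {x} e = Sum.[
    (λ e′ → here (-≈0⇒≈ (trans (sym (eval-X- z x)) e′))) ,
    (λ e′ → there (eval-linearProduct⁻ zs e′)) ]′
    (integral (trans (sym (eval-*ₚ (X- z) (linearProduct zs) x)) e))

  module Roots {n} (F : MX.Poly) (γ : Vector Carrier n) (split : map ι F ≈ₚ productₚ (λ i → X- (γ i)))
    (simple : NoMultipleRoot (map ι F)) where

    private
      split′ : map ι F ≈ₚ linearProduct (tabulate γ)
      split′ = ≡.subst (map ι F ≈ₚ_) (productₚ-tabulate γ) split

    γ-distinct : Distinct γ
    γ-distinct {i} {j} e with AllPairs-tabulate (noMultipleRoot-distinct (tabulate γ)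
      (NoMultipleRoot-resp {map ι F} {linearProduct (tabulate γ)} split′ simple)) i j
    ... | inj₁ i≡j       = i≡j
    ... | inj₂ (inj₁ ne) = ⊥-elim (ne e)
    ... | inj₂ (inj₂ ne) = ⊥-elim (ne (sym e))

    root⇒γ : ∀ {x} → IsRoot (map ι F) x → ∃[ i ] x ≈ γ i
    root⇒γ {x} root = Any.tabulate⁻ (eval-linearProduct⁻ (tabulate γ)
      (trans (sym (eval-congˡ (map ι F) (linearProduct (tabulate γ)) x split′)) root))

    γ-root : ∀ i → IsRoot (map ι F) (γ i)
    γ-root i = trans (eval-congˡ (map ι F) (linearProduct (tabulate γ)) (γ i) split′) (eval-linearProduct (Any.tabulate⁺ {f = γ} i refl))

    -- The base-changed polynomial cut to its exact degree, since `Galois` wants `monic f` with as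
    -- many lower coefficients as there are roots.
    f : Poly
    f = lower-coefficients n (map ι F)

    length-f : length f ≡ n
    length-f = List.length-applyUpTo (coeff (map ι F)) n

    monic-f : monic f ≈ₚ map ι F
    monic-f = monic-lower-coefficients {p = map ι F} (IsMonic-resp {p = map ι F} {q = linearProduct (tabulate γ)} split′
      (≡.subst (λ k → IsMonic k (linearProduct (tabulate γ))) (List.length-tabulate γ) (linearProduct-monic (tabulate γ))))

    open Galois algebraicallyClosed f

    γ-rootᶠ : ∀ i → IsRootᶠ (γ i)
    γ-rootᶠ i = trans (eval-congˡ (monic f) (map ι F) (γ i) monic-f) (γ-root i)

    coeff-ι : ∀ p i → ι (MX.coeff p i) ≈ coeff (map ι p) i
    coeff-ι []      i       = ι.0#-homo
    coeff-ι (a ∷ p) zero    = refl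
    coeff-ι (a ∷ p) (suc i) = coeff-ι p i

    f-closed : ∀ {t} {T : Pred (Carrier × Carrier) t} → PP.IsSubfield T → FixesBase T → All T (map diag f)
    f-closed T-subfield fixes = All.map⁺ (All.applyUpTo⁺₂ _ n λ i →
      PP.IsSubfield.≈-closed T-subfield (coeff-ι F i , coeff-ι F i) (fixes (MX.coeff F i)))

    -- `T` fixes the coefficients of `F`, so it sends roots to roots; it is injective, so the
    -- induced map of indices is a permutation.
    permutes : ∀ {t} {T : Pred (Carrier × Carrier) t} → PP.IsSubfield T → FixesBase T →
      All (λ z → ∃[ y ] T (z , y)) (tabulate γ) → ∃[ π ] ∀ i → T (γ i , γ (π ⟨$⟩ʳ i))
    permutes {T = T} T-subfield fixes images = π , λ i → ≡.subst (λ j → T (γ i , γ j)) (≡.sym (proj₂ permutation-π i)) (proj₂ (to i))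
      where
      open PP.IsSubfield T-subfield
      to : ∀ i → ∃[ j ] T (γ i , γ j)
      to i =
        let y , zy∈T = All.tabulate⁻ images i
            fs = f-closed T-subfield fixes
            e = zero-to-zero T-subfield (eval-closed (monic-closed fs) zy∈T)
                  (trans (reflexive (proj₁-eval (PP.monic (map diag f)) (γ i) y)) (annihilated T-subfield (γ-rootᶠ i)))
            root = trans (sym (eval-congˡ (monic f) (map ι F) y monic-f))
              (trans (reflexive (≡.trans (≡.cong (λ p → eval p y) (≡.sym (map-diag proj₂ (λ _ → ≡.refl) f)))
                (≡.sym (proj₂-eval (PP.monic (map diag f)) (γ i) y)))) e)
            j , y≈γj = root⇒γ root
        in j , ≈-closed (refl , y≈γj) zy∈T
      permutation-π = injective⇒permutation (proj₁ ∘ to) λ {i} {j} e →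
        γ-distinct (injective T-subfield (proj₂ (to i)) (proj₂ (to j)) (reflexive (≡.cong γ e)))
      π = proj₁ permutation-π

    γ∈Spl : ∀ i → Spl M L ι F (γ i)
    γ∈Spl i = gen (γ-root i)

    -- The one fact of Galois theory behind both directions: K is a splitting field when the
    -- inclusions are proved, and the image of M when a root in M is sought.
    moves-γ : ∀ {K : Pred Carrier level} → IsSubfield K → (∀ a → K (ι a)) → ∀ {x} →
      (∀ {T : Pred (Carrier × Carrier) level} → PP.IsSubfield T → FixesBase T → (∀ {y z} → T (y , z) → y ≈ z) →
        (∀ i → T (diag (γ i))) → T (diag x)) → ¬ K x →
      Σ (Pred (Carrier × Carrier) level) λ T → PP.IsSubfield T × (∀ {y} → K y → T (diag y)) ×
        (∃[ π ] ∀ i → T (γ i , γ (π ⟨$⟩ʳ i))) × (∃[ y ] (T (x , y) × ¬ y ≈ x))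
    moves-γ {K} K-subfield ι∈K {x} generates x∉K =
      let S-subfield = identity-isSubfield K-subfield
          E , images , moved = moves γ γ-distinct length-f γ-rootᶠ {m₀} S-subfield proj₂
            (f-closed S-subfield (λ a → ι∈K a , refl)) (All.tabulate⁺ {f = γ} γ-rootᶠ)
            (λ E diagonal γs∈E → generates (T-subfield E) (λ a → extends E (ι∈K a , refl)) diagonal (All.tabulate⁻ γs∈E))
            (x∉K ∘ proj₁)
          K⊆T = λ {y} y∈K → extends E {diag y} (y∈K , refl)
      in T E , T-subfield E , K⊆T , permutes (T-subfield E) (λ a → K⊆T (ι∈K a)) images , moved

-- From partial automorphisms to elements of the Galois group.

module GaloisGroup (em : ∀ {ℓ} → ExcludedMiddle ℓ) {m₀ m₁ m₂ c ℓ ℓ′}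
  (M : HeytingField m₀ m₁ m₂) (L : HeytingField c ℓ ℓ′)
  (ι : HeytingField.Carrier M → HeytingField.Carrier L) (closure : IsAlgebraicClosure M L ι)
  (A : Polynomial.Poly (rawField M)) where

  open IsAlgebraicClosure closure renaming (isFieldEmbedding to ι-emb)
  open CommutativeRing (fieldRing L) hiding (zero)
  open Polynomial rawRing
  open ClassicalField em L
  open PartialAutomorphisms em L
  open SplittingFields em M L ι closure
  private
    module PP = PolynomialProperties L×L
    Γ = GalSpl M L ι ι-emb A
    Aut = Group.Carrier Γ

  infixr 9 _⟨_⟩
  _⟨_⟩ : Aut → ∀ {x} → Spl M L ι A x → Carrier
  σ ⟨ x∈ ⟩ = proj₁ (Automorphism.⟦_⟧ σ (_ , x∈))

  module _ (σ : Aut) where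

    open Automorphism σ

    -- In particular the value does not depend on which proof of membership accompanies x.
    ⟨⟩-cong : ∀ {x y} (x∈ : Spl M L ι A x) (y∈ : Spl M L ι A y) → x ≈ y → σ ⟨ x∈ ⟩ ≈ σ ⟨ y∈ ⟩
    ⟨⟩-cong x∈ y∈ x≈y = ⟦⟧-cong {_ , x∈} {_ , y∈} x≈y

    ⟨⟩-eval : ∀ p {x} (x∈ : Spl M L ι A x) → Σ (Spl M L ι A (eval (map ι p) x)) λ w∈ → σ ⟨ w∈ ⟩ ≈ eval (map ι p) (σ ⟨ x∈ ⟩)
    ⟨⟩-eval []      x∈ = _ , 0#-homo
    ⟨⟩-eval (a ∷ p) x∈ =
      let w∈ , e = ⟨⟩-eval p x∈
      in add (base a) (mul x∈ w∈) ,
         trans (+-homo (_ , base a) (_ , mul x∈ w∈)) (+-cong (fixesBase a) (trans (*-homo (_ , x∈) (_ , w∈)) (*-congˡ e)))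

    ⟨⟩-root : ∀ p {x} (x∈ : Spl M L ι A x) → IsRoot (map ι p) x → IsRoot (map ι p) (σ ⟨ x∈ ⟩)
    ⟨⟩-root p x∈ root = let w∈ , e = ⟨⟩-eval p x∈ in trans (sym e) (trans (⟦⟧-cong {_ , w∈} {_ , proj₁ (⟨⟩-eval [] x∈)} root) 0#-homo)

  galois-action : ∀ {n} (δ : Vector Carrier n) → Distinct δ → (δ∈ : ∀ i → Spl M L ι A (δ i)) →
    (∀ σ i → ∃[ k ] σ ⟨ δ∈ i ⟩ ≈ δ k) → (∀ i k → ∃[ σ ] σ ⟨ δ∈ i ⟩ ≈ δ k) → TransitiveAction Γ n
  galois-action δ distinct δ∈ permute transitive = record
    { act      = λ σ i → proj₁ (permute σ i)
    ; act-cong = λ {σ} {ρ} σ≈ρ i → unique σ i (trans (σ≈ρ (_ , δ∈ i)) (proj₂ (permute ρ i)))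
    ; act-ε    = λ i → unique (Group.ε Γ) i refl
    ; act-∙    = λ σ ρ i → let k , e = permute ρ i in
        unique (Group._∙_ Γ σ ρ) i (trans (⟨⟩-cong σ (proj₂ (Automorphism.⟦_⟧ ρ (_ , δ∈ i))) (δ∈ k) e) (proj₂ (permute σ k)))
    ; reach    = λ i k → let σ , e = transitive i k in σ , unique σ i e
    }
    where
    unique : ∀ σ i {k} → σ ⟨ δ∈ i ⟩ ≈ δ k → proj₁ (permute σ i) ≡ k
    unique σ i e = distinct (trans (sym (proj₂ (permute σ i))) e)

  -- Even when the two splitting fields coincide, their elements carry different proofs of
  -- membership; exchanging these moves an automorphism from one field to the other.
  transfer : ∀ {B} → Spl M L ι A ⊆ Spl M L ι B → Spl M L ι B ⊆ Spl M L ι A →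
    (ρ : Group.Carrier (GalSpl M L ι ι-emb B)) →
    ∃[ σ ] ∀ {x} (x∈A : Spl M L ι A x) (x∈B : Spl M L ι B x) → σ ⟨ x∈A ⟩ ≈ proj₁ (Automorphism.⟦_⟧ ρ (x , x∈B))
  transfer to from ρ = record
    { ⟦_⟧ = λ (x , x∈) → let y , y∈ = ⟦ x , to x∈ ⟧ in y , from y∈
    ; isRingIsomorphism = record
      { isRingMonomorphism = record
        { isRingHomomorphism = record
          { isSemiringHomomorphism = record
            { isNearSemiringHomomorphism = record
              { +-isMonoidHomomorphism = record
                { isMagmaHomomorphism = record
                  { isRelHomomorphism = record { cong = λ { {_ , x∈} {_ , y∈} → ⟦⟧-cong {_ , to x∈} {_ , to y∈} } }
                  ; homo = λ (_ , x∈) (_ , y∈) → trans (⟦⟧-cong {_ , to (add x∈ y∈)} {_ , add (to x∈) (to y∈)} refl) (+-homo _ _)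
                  }
                ; ε-homo = trans (⟦⟧-cong refl) 0#-homo
                }
              ; *-homo = λ (_ , x∈) (_ , y∈) → trans (⟦⟧-cong {_ , to (mul x∈ y∈)} {_ , mul (to x∈) (to y∈)} refl) (*-homo _ _)
              }
            ; 1#-homo = trans (⟦⟧-cong refl) 1#-homo
            }
          ; -‿homo = λ (_ , x∈) → trans (⟦⟧-cong {_ , to (neg x∈)} {_ , neg (to x∈)} refl) (-‿homo _)
          }
        ; injective = λ { {_ , x∈} {_ , y∈} → injective′ {_ , to x∈} {_ , to y∈} }
        }
      ; surjective = λ (y , y∈) → let (x , x∈) , e = surjective (y , to y∈) in
          (x , from x∈) , λ { {_ , z∈} z≈x → e {_ , to z∈} z≈x }
      }
    ; fixesBase = λ a → trans (⟦⟧-cong {_ , to (base a)} {_ , base a} refl) (fixesBase a)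
    } , λ x∈A x∈B → ⟦⟧-cong {_ , to x∈A} {_ , x∈B} refl
    where open Automorphism ρ renaming (injective to injective′)

  module _ {t} {T : Pred (Carrier × Carrier) t} (T-subfield : PP.IsSubfield T) (fixes : FixesBase T)
    (to : ∀ {x} → IsRoot (map ι A) x → ∃[ y ] (T (x , y) × Spl M L ι A y))
    (from : ∀ {y} → IsRoot (map ι A) y → ∃[ x ] (T (x , y) × Spl M L ι A x)) where

    open PP.IsSubfield T-subfield

    private
      swapped : PP.IsSubfield (T ∘ swap)
      swapped = record
        { isSubring = record
          { ≈-closed = λ e → ≈-closed (swap e)
          ; 1-closed = 1-closed
          ; +-closed = +-closed
          ; *-closed = *-closed
          ; -‿closed = -‿closed
          }
        ; inverse = λ xy∈T → Sum.map swap (λ (z , z∈T , e) → swap z , z∈T , swap e) (inverse xy∈T)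
        }

      image : ∀ {x} → Spl M L ι A x → ∃[ y ] (T (x , y) × Spl M L ι A y)
      image = adjoin-image T-subfield fixes to

      preimage : ∀ {y} → Spl M L ι A y → ∃[ x ] (T (x , y) × Spl M L ι A x)
      preimage = adjoin-image swapped fixes from

    -- The graph gives values and the swapped graph gives preimages. This turns a partial
    -- automorphism into a group element, to which equivariance can be applied.
    graph-automorphism : ∃[ σ ] ∀ {x} (x∈ : Spl M L ι A x) → T (x , σ ⟨ x∈ ⟩)
    graph-automorphism = record
      { ⟦_⟧ = λ (x , x∈) → let y , _ , y∈ = image x∈ in y , y∈
      ; isRingIsomorphism = record
        { isRingMonomorphism = record
          { isRingHomomorphism = record
            { isSemiringHomomorphism = record
              { isNearSemiringHomomorphism = record
                { +-isMonoidHomomorphism = record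
                  { isMagmaHomomorphism = record
                    { isRelHomomorphism = record { cong = λ { {_ , x∈} {_ , y∈} → functional T-subfield (graph x∈) (graph y∈) } }
                    ; homo = λ (_ , x∈) (_ , y∈) → functional T-subfield (graph (add x∈ y∈)) (+-closed (graph x∈) (graph y∈)) refl
                    }
                  ; ε-homo = functional T-subfield (graph (proj₂ (HeytingField.0# (SplField M L ι ι-emb A)))) 0-closed refl
                  }
                ; *-homo = λ (_ , x∈) (_ , y∈) → functional T-subfield (graph (mul x∈ y∈)) (*-closed (graph x∈) (graph y∈)) refl
                }
              ; 1#-homo = functional T-subfield (graph (proj₂ (HeytingField.1# (SplField M L ι ι-emb A)))) 1-closed refl
              }
            ; -‿homo = λ (_ , x∈) → functional T-subfield (graph (neg x∈)) (-‿closed (graph x∈)) refl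
            }
          ; injective = λ { {_ , x∈} {_ , y∈} → injective T-subfield (graph x∈) (graph y∈) }
          }
        ; surjective = λ (y , y∈) → let x , xy∈T , x∈ = preimage y∈ in
            (x , x∈) , λ { {_ , z∈} z≈x → functional T-subfield (graph z∈) xy∈T z≈x }
        }
      ; fixesBase = λ a → functional T-subfield (graph (base a)) (fixes a) refl
      } , graph
      where
      graph : ∀ {x} (x∈ : Spl M L ι A x) → T (x , proj₁ (image x∈))
      graph x∈ = proj₁ (proj₂ (image x∈))

-- Vandermonde solutions and the two directions of the equivalence.

module Corollary (em : ∀ {ℓ} → ExcludedMiddle ℓ) {m₀ m₁ m₂ c ℓ ℓ′}
  (M : HeytingField m₀ m₁ m₂) (L : HeytingField c ℓ ℓ′)
  (ι : HeytingField.Carrier M → HeytingField.Carrier L) (closure : IsAlgebraicClosure M L ι)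
  {n} (A B : Polynomial.Poly (rawField M))
  (A-simple : Polynomial.NoMultipleRoot (rawField L) (map ι A))
  (B-simple : Polynomial.NoMultipleRoot (rawField L) (map ι B))
  (α β : Vector (HeytingField.Carrier L) n)
  (A-split : Polynomial._≈ₚ_ (rawField L) (map ι A)
    (Polynomial.productₚ (rawField L) (λ i → Polynomial.X-_ (rawField L) (α i))))
  (B-split : Polynomial._≈ₚ_ (rawField L) (map ι B)
    (Polynomial.productₚ (rawField L) (λ i → Polynomial.X-_ (rawField L) (β i))))
  (cs : Permutation′ n → Vector (HeytingField.Carrier L) n) (solves : SolvesVandermonde (rawField L) α β cs)
  where

  open IsAlgebraicClosure closure renaming (isFieldEmbedding to ι-emb)
  private
    level = m₀ ⊔ c ⊔ ℓ
  open CommutativeRing (fieldRing L) hiding (zero)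
  open Polynomial rawRing
  open PolynomialProperties (fieldRing L)
  open LinearFactors (fieldRing L)
  open ClassicalField em L
  open PartialAutomorphisms em L
  open Interpolation L×L
  open RingProperties ring using (-1*x≈-x)
  open SplittingFields em M L ι closure
  private
    module P  = CommutativeRing L×L
    module PX = Polynomial P.rawRing
    module PP = PolynomialProperties L×L
    module α  = Roots A α A-split A-simple
    module β  = Roots B β B-split B-simple

  -- The difference of two interpolants of length n vanishes at the n distinct points αᵢ, hence is
  -- zero.
  cs-unique : ∀ ρ p → length p ≡ n → (∀ i → eval p (α i) ≈ β (ρ ⟨$⟩ʳ i)) → ∀ l → coeff p (toℕ l) ≈ cs ρ l
  cs-unique ρ p length-p values l = -≈0⇒≈ (trans
    (sym (trans (coeff-+ₚ p (map (- 1# *_) q) (toℕ l)) (+-congˡ (trans (coeff-map* (- 1#) q (toℕ l))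
      (trans (-1*x≈-x _) (-‿cong (reflexive (coeff-tabulate (cs ρ) l))))))))
    (coeff-zero difference-zero (toℕ l)))
    where
    q = tabulate (cs ρ)
    length-q : length (map (- 1# *_) q) ≡ n
    length-q = ≡.trans (List.length-map (- 1# *_) q) (List.length-tabulate (cs ρ))
    difference-zero : All (_≈ 0#) (p +ₚ map (- 1# *_) q)
    difference-zero = few-roots α α.γ-distinct (p +ₚ map (- 1# *_) q)
      (ℕ.≤-reflexive (≡.trans (length-+ₚ-≡ p _ (≡.trans length-p (≡.sym length-q))) length-q))
      λ i → trans (eval-+ₚ p (map (- 1# *_) q) (α i)) (trans
        (+-cong (values i) (trans (eval-map* (- 1#) q (α i)) (trans (-1*x≈-x _)
          (-‿cong (trans (eval-tabulate (cs ρ) (α i)) (sym (solves ρ i)))))))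
        (-‿inverseʳ _))

  -- `cs` is an arbitrary function on permutations; that it respects their pointwise equality
  -- follows from uniqueness of the solution.
  cs-cong : ∀ {ρ τ} → ρ Perm.≈ τ → ∀ l → cs ρ l ≈ cs τ l
  cs-cong {ρ} {τ} ρ≈τ l = trans (reflexive (≡.sym (coeff-tabulate (cs ρ) l)))
    (cs-unique τ (tabulate (cs ρ)) (List.length-tabulate (cs ρ))
      (λ i → trans (eval-tabulate (cs ρ) (α i)) (trans (sym (solves ρ i)) (reflexive (≡.cong β (ρ≈τ i))))) l)

  module _ {t} {T : Pred (Carrier × Carrier) t} (T-subfield : PP.IsSubfield T) where

    open PP.IsSubfield T-subfield

    -- σ (c^τ) = c^ρ for ρ = t τ s⁻¹, where s and t describe how σ permutes the αᵢ and the βᵢ.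
    cs-image : ∀ {s : Permutation′ n} {t : Fin n → Fin n} → (∀ i → T (α i , α (s ⟨$⟩ʳ i))) → (∀ i → T (β i , β (t i))) →
      ∀ {τ ρ : Permutation′ n} → (∀ i → ρ ⟨$⟩ʳ (s ⟨$⟩ʳ i) ≡ t (τ ⟨$⟩ʳ i)) → ∀ l → T (cs τ l , cs ρ l)
    cs-image {s} {t} αs βt {τ} {ρ} ρs≡tτ l =
      -- Interpolating pairs solves two Vandermonde systems at once: the first components give c^τ
      -- and, after reindexing by s, the second give c^ρ. All coefficients are pairs in `T`.
      let p , ps , length-p , values = interpolate isSubring xs (λ i → β (τ ⟨$⟩ʳ i) , β (t (τ ⟨$⟩ʳ i))) αs (λ i → βt (τ ⟨$⟩ʳ i)) inverses
      in ≈-closed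
        ( trans (reflexive (proj₁-coeff p (toℕ l))) (cs-unique τ (map proj₁ p) (≡.trans (List.length-map proj₁ p) length-p)
            (λ i → trans (reflexive (≡.sym (proj₁-eval p _ _))) (proj₁ (values i))) l)
        , trans (reflexive (proj₂-coeff p (toℕ l))) (cs-unique ρ (map proj₂ p) (≡.trans (List.length-map proj₂ p) length-p)
            (λ i → ≡.subst (λ i → eval (map proj₂ p) (α i) ≈ β (ρ ⟨$⟩ʳ i)) (Perm.inverseʳ s {i})
              (trans (reflexive (≡.sym (proj₂-eval p (α (s Perm.⟨$⟩ˡ i)) (α (s ⟨$⟩ʳ (s Perm.⟨$⟩ˡ i))))))
                (trans (proj₂ (values (s Perm.⟨$⟩ˡ i)))
                (reflexive (≡.cong β (≡.sym (ρs≡tτ (s Perm.⟨$⟩ˡ i)))))))) l) )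
        (coeff-closed ps (toℕ l))
      where
      xs : Vector (Carrier × Carrier) n
      xs i = α i , α (s ⟨$⟩ʳ i)
      proj₁-coeff : ∀ p i → proj₁ (PX.coeff p i) ≡ coeff (map proj₁ p) i
      proj₁-coeff []      i       = ≡.refl
      proj₁-coeff (a ∷ p) zero    = ≡.refl
      proj₁-coeff (a ∷ p) (suc i) = proj₁-coeff p i
      inverses : ∀ {i j} → i ≢ j → ∃[ w ] (T w × (xs i P.- xs j) P.* w P.≈ P.1#)
      inverses {i} {j} i≢j = Sum.[ (λ e → ⊥-elim (i≢j (α.γ-distinct (-≈0⇒≈ (proj₁ e))))) , (λ w → w) ]′
        (inverse (+-closed (αs i) (-‿closed (αs j))))

  module _ (j : Fin n) where

    roots-F : List Carrier
    roots-F = map (λ τ → cs τ j) (allPermutations n)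

    F≡linearProduct : F-poly (rawField L) cs j ≡ linearProduct roots-F
    F≡linearProduct = ≡.cong listProductₚ (List.map-∘ (allPermutations n))

    root⇒cs : ∀ {x} → IsRoot (F-poly (rawField L) cs j) x → ∃[ τ ] x ≈ cs τ j
    root⇒cs {x} root =
      let τ , _ , e = find (Any.map⁻ (eval-linearProduct⁻ roots-F (≡.subst (λ p → IsRoot p x) F≡linearProduct root)))
      in τ , e

    cs⇒root : ∀ {x} τ → x ≈ cs τ j → IsRoot (F-poly (rawField L) cs j) x
    cs⇒root {x} τ e = ≡.subst (λ p → IsRoot p x) (≡.sym F≡linearProduct)
      (eval-linearProduct {roots-F} (Any.map⁺ (Any.map (λ τ≈ρ → trans e (cs-cong τ≈ρ j)) (∈-allPermutations τ))))

    module _ (F-simple : NoMultipleRoot (F-poly (rawField L) cs j)) where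

      -- Simplicity separates the entries of the list, which contains each permutation only up to
      -- pointwise equality; hence both are first replaced by listed representatives.
      cs-injective : ∀ ρ τ → cs ρ j ≈ cs τ j → ρ Perm.≈ τ
      cs-injective ρ τ e
        with ρ′ , ρ′∈ , ρ≈ρ′ ← find (∈-allPermutations ρ)
        with τ′ , τ′∈ , τ≈τ′ ← find (∈-allPermutations τ)
        with AllPairs-lookup (AllPairs.map⁻ (noMultipleRoot-distinct roots-F (≡.subst NoMultipleRoot F≡linearProduct F-simple))) ρ′∈ τ′∈
      ... | inj₁ ≡.refl     = λ i → ≡.trans (ρ≈ρ′ i) (≡.sym (τ≈τ′ i))
      ... | inj₂ (inj₁ ne) = ⊥-elim (ne (trans (sym (cs-cong ρ≈ρ′ j)) (trans e (cs-cong τ≈τ′ j))))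
      ... | inj₂ (inj₂ ne) = ⊥-elim (ne (sym (trans (sym (cs-cong ρ≈ρ′ j)) (trans e (cs-cong τ≈τ′ j)))))

      module _ {τ : Permutation′ n} {a} (c≈ιa : cs τ j ≈ ι a) where

        rigid : ∀ {t} {T : Pred (Carrier × Carrier) t} (T-subfield : PP.IsSubfield T) → FixesBase T →
          ∀ {s t : Permutation′ n} → (∀ i → T (α i , α (s ⟨$⟩ʳ i))) → (∀ i → T (β i , β (t ⟨$⟩ʳ i))) →
          ∀ i → τ ⟨$⟩ʳ (s ⟨$⟩ʳ i) ≡ t ⟨$⟩ʳ (τ ⟨$⟩ʳ i)
        rigid T-subfield fixes {s} {t} αs βt i = ≡.trans (cs-injective τ ρ
            (trans c≈ιa (sym (functional T-subfield
              (cs-image T-subfield {s} {t ⟨$⟩ʳ_} αs βt {τ} {ρ} ρs≡tτ j) (fixes a) c≈ιa))) (s ⟨$⟩ʳ i))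
            (ρs≡tτ i)
          where
          ρ : Permutation′ n
          -- The left factor of `∘ₚ` acts first, so this is t τ s⁻¹.
          ρ = Perm.flip s Perm.∘ₚ (τ Perm.∘ₚ t)
          ρs≡tτ : ∀ i → ρ ⟨$⟩ʳ (s ⟨$⟩ʳ i) ≡ t ⟨$⟩ʳ (τ ⟨$⟩ʳ i)
          ρs≡tτ i = ≡.cong (λ k → t ⟨$⟩ʳ (τ ⟨$⟩ʳ k)) (Perm.inverseˡ s {i})

  -- A root outside K would be moved by some `T` over K, although every such `T` permutes the roots
  -- trivially. Once the roots lie in K, the identity graph on K carries the inclusion to the whole
  -- splitting field.
  fixed⇒⊆ : ∀ {F} {γ : Vector Carrier n} (split : map ι F ≈ₚ productₚ (λ i → X- (γ i))) (simple : NoMultipleRoot (map ι F)) →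
    ∀ {K : Pred Carrier level} → IsSubfield K → (∀ a → K (ι a)) →
    (∀ {T : Pred (Carrier × Carrier) level} → PP.IsSubfield T → (∀ {x} → K x → T (diag x)) →
      ∀ {π : Permutation′ n} → (∀ i → T (γ i , γ (π ⟨$⟩ʳ i))) → ∀ i → π ⟨$⟩ʳ i ≡ i) →
    Spl M L ι F ⊆ K
  fixed⇒⊆ {F} {γ} split simple {K} K-subfield ι∈K rigid x∈Spl =
    proj₁ (proj₁ (proj₂ (adjoin-image (identity-isSubfield K-subfield) (λ a → ι∈K a , refl)
      (λ root → _ , (let i , x≈γ = root⇒γ root in IsSubfield.≈-closed K-subfield (sym x≈γ) (γ∈K i) , refl) , gen root) x∈Spl)))
    where
    open Roots F γ split simple
    γ∈K : ∀ i → K (γ i)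
    γ∈K i with em {P = K (γ i)}
    ... | yes γ∈ = γ∈
    ... | no γ∉ =
      let T , T-subfield , K⊆T , (π , γπ) , y , γy∈T , y≉γ = moves-γ K-subfield ι∈K (λ _ _ _ γs∈T → γs∈T i) γ∉
      in ⊥-elim (y≉γ (trans (functional T-subfield γy∈T (γπ i) refl) (reflexive (≡.cong γ (rigid T-subfield K⊆T {π} γπ i)))))

  root⇒≐ : ∀ j → NoMultipleRoot (F-poly (rawField L) cs j) → ∃[ x ] IsRoot (F-poly (rawField L) cs j) (ι x) →
    Spl M L ι A ≐ Spl M L ι B
  root⇒≐ j F-simple (a , root) =
    fixed⇒⊆ A-split A-simple (adjoin-isSubfield-L (IsRoot (map ι B))) base
      -- Over the splitting field of `B` all β are fixed, so rigidity reads τ s = τ and τ is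
      -- cancelled. Over that of `A` it reads τ = t τ, evaluated at τ⁻¹ i.
      (λ T-subfield K⊆T {s} αs i → Injection.injective (↔⇒↣ τ)
        (rigid j F-simple {τ} {a} c≈ιa T-subfield (λ a → K⊆T (base a)) {s} {Perm.id} αs (λ i → K⊆T (β.γ∈Spl i)) i)) ,
    fixed⇒⊆ B-split B-simple (adjoin-isSubfield-L (IsRoot (map ι A))) base
      (λ T-subfield K⊆T {t} βt i → ≡.subst (λ i → t ⟨$⟩ʳ i ≡ i) (Perm.inverseʳ τ)
        (≡.sym (rigid j F-simple {τ} {a} c≈ιa T-subfield (λ a → K⊆T (base a)) {Perm.id} {t} (λ i → K⊆T (α.γ∈Spl i)) βt (τ Perm.⟨$⟩ˡ i))))
    where
    τ = proj₁ (root⇒cs j root)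
    c≈ιa : cs τ j ≈ ι a
    c≈ιa = sym (proj₂ (root⇒cs j root))

  module _ (A⊆B : Spl M L ι A ⊆ Spl M L ι B) (B⊆A : Spl M L ι B ⊆ Spl M L ι A)
    (A-transitive : TransitiveOnRoots M L ι ι-emb A) (B-transitive : TransitiveOnRoots M L ι ι-emb B) where

    open GaloisGroup em M L ι closure A
    open TransitiveAction

    β∈A : ∀ i → Spl M L ι A (β i)
    β∈A i = B⊆A (β.γ∈Spl i)

    -- One group must act on both families of roots; transitivity on the β is known for the group of
    -- `B` and comes over by `transfer`.
    α-action β-action : TransitiveAction (GalSpl M L ι ι-emb A) n
    α-action = galois-action α α.γ-distinct α.γ∈Spl
      (λ σ i → α.root⇒γ (⟨⟩-root σ A (α.γ∈Spl i) (α.γ-root i)))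
      (λ i k → A-transitive (α i , α.γ∈Spl i) (α k , α.γ∈Spl k) (α.γ-root i) (α.γ-root k))
    β-action = galois-action β β.γ-distinct β∈A
      (λ σ i → β.root⇒γ (⟨⟩-root σ B (β∈A i) (β.γ-root i)))
      (λ i k →
        let ρ , e  = B-transitive (β i , β.γ∈Spl i) (β k , β.γ∈Spl k) (β.γ-root i) (β.γ-root k)
            σ , e′ = transfer {B} A⊆B B⊆A ρ
        in σ , trans (e′ (β∈A i) (β.γ∈Spl i)) e)

    -- This is `cs-image` for the identity graph on the splitting field, with both permutations
    -- trivial.
    cs∈Spl : ∀ τ l → Spl M L ι A (cs τ l)
    cs∈Spl τ l = proj₁ (cs-image (identity-isSubfield (adjoin-isSubfield-L (IsRoot (map ι A)))) {Perm.id} {λ i → i}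
      (λ i → α.γ∈Spl i , refl) (λ i → β∈A i , refl) {τ} {τ} (λ _ → ≡.refl) l)

    module _ {t} {T : Pred (Carrier × Carrier) t} (T-subfield : PP.IsSubfield T) (fixes : FixesBase T)
      {s : Permutation′ n} (αs : ∀ i → T (α i , α (s ⟨$⟩ʳ i))) where

      open PP.IsSubfield T-subfield

      α-permuting-automorphism : ∃[ σ ] ∀ {x} (x∈ : Spl M L ι A x) → T (x , σ ⟨ x∈ ⟩)
      α-permuting-automorphism = graph-automorphism T-subfield fixes
        (λ root → let i , x≈αi = α.root⇒γ root in
          α (s ⟨$⟩ʳ i) , ≈-closed (sym x≈αi , refl) (αs i) , α.γ∈Spl (s ⟨$⟩ʳ i))
        (λ root → let i , y≈αi = α.root⇒γ root in
          α (s Perm.⟨$⟩ˡ i) ,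
          ≈-closed (refl , trans (reflexive (≡.cong α (Perm.inverseʳ s))) (sym y≈αi)) (αs (s Perm.⟨$⟩ˡ i)) ,
          α.γ∈Spl (s Perm.⟨$⟩ˡ i))

      -- The restriction σ of `T` to the splitting field shows how `T` permutes the β as well.
      -- Equivariance then makes ρ = τ admissible in `cs-image`.
      equivariant⇒fixed : ∀ {τ : Permutation′ n} → (∀ σ i → act β-action σ (τ ⟨$⟩ʳ i) ≡ τ ⟨$⟩ʳ (act α-action σ i)) →
        ∀ j → T (diag (cs τ j))
      equivariant⇒fixed {τ} equivariant = fixed (proj₁ α-permuting-automorphism) (proj₂ α-permuting-automorphism)
        where
        fixed : ∀ σ → (∀ {x} (x∈ : Spl M L ι A x) → T (x , σ ⟨ x∈ ⟩)) → ∀ j → T (diag (cs τ j))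
        fixed σ graph = cs-image T-subfield {s} {act β-action σ} αs βσ {τ} {τ}
          (λ i → ≡.trans (≡.cong (τ ⟨$⟩ʳ_) (s≡σ i)) (≡.sym (equivariant σ i)))
          where
          βσ : ∀ i → T (β i , β (act β-action σ i))
          βσ i = ≈-closed (refl , proj₂ (β.root⇒γ (⟨⟩-root σ B (β∈A i) (β.γ-root i)))) (graph (β∈A i))
          s≡σ : ∀ i → s ⟨$⟩ʳ i ≡ act α-action σ i
          s≡σ i = α.γ-distinct (trans (functional T-subfield (αs i) (graph (α.γ∈Spl i)) refl)
            (proj₂ (α.root⇒γ (⟨⟩-root σ A (α.γ∈Spl i) (α.γ-root i)))))

    ≐⇒root : ∀ {τ : Permutation′ n} → (∀ σ i → act β-action σ (τ ⟨$⟩ʳ i) ≡ τ ⟨$⟩ʳ (act α-action σ i)) →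
      ∀ j → ∃[ x ] IsRoot (F-poly (rawField L) cs j) (ι x)
    ≐⇒root {τ} equivariant j with em {P = Image (cs τ j)}
    ... | yes (lift (a , ιa≈c)) = a , cs⇒root j τ ιa≈c
    ... | no c∉M =
      let T , T-subfield , M⊆T , (s , αs) , y , cy∈T , y≉c =
            α.moves-γ image-isSubfield (λ a → lift (a , refl)) generates c∉M
          cc∈T = equivariant⇒fixed T-subfield (λ a → M⊆T (lift (a , refl))) {s} αs {τ} equivariant j
      in ⊥-elim (y≉c (functional T-subfield cy∈T cc∈T refl))
      where
      generates : ∀ {T : Pred (Carrier × Carrier) level} → PP.IsSubfield T → FixesBase T →
        (∀ {y z} → T (y , z) → y ≈ z) → (∀ i → T (diag (α i))) → T (diag (cs τ j))
      generates T-subfield fixes diagonal α∈T =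
        -- The coefficient lies in the field generated over M by the α, so `T` is defined at it, and
        -- a diagonal `T` can only fix it.
        let y , cy∈T , _ = adjoin-image T-subfield fixes
              (λ root → let i , x≈αi = α.root⇒γ root in
                α i , PP.IsSubfield.≈-closed T-subfield (sym x≈αi , refl) (α∈T i) , α.γ∈Spl i) (cs∈Spl τ j)
        in PP.IsSubfield.≈-closed T-subfield (refl , sym (diagonal cy∈T)) cy∈T

corollary3p9 :
  (∀ {ℓ} → ExcludedMiddle ℓ) →
  ∀ {k₀ k₁ k₂ m₀ m₁ m₂ c₀ c₁ c₂ g : Level}
    (n : ℕ) → 3 ≤ n →
    (k : HeytingField k₀ k₁ k₂) (M : HeytingField m₀ m₁ m₂) (M̄ : HeytingField c₀ c₁ c₂) →
    let module k = HeytingField k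
        module M = HeytingField M
        module M̄ = HeytingField M̄
        open Polynomial (rawField M̄)
    in
    (κ : k.Carrier → M.Carrier) → IsFieldEmbedding k M κ →
    Infinite M.setoid →
    (ι : M.Carrier → M̄.Carrier) (closure : IsAlgebraicClosure M M̄ ι) →
    let ι-emb = IsAlgebraicClosure.isFieldEmbedding closure in
    (a b : Vector M.Carrier n) →
    let fᵃ = genericPoly (rawField M) a
        fᵇ = genericPoly (rawField M) b
        Spl[_] = Spl M M̄ ι
        Gal[_] = GalSpl M M̄ ι ι-emb
        TransitiveOnRoots[_] = TransitiveOnRoots M M̄ ι ι-emb
    in
    NoMultipleRoot (map ι fᵃ) →
    NoMultipleRoot (map ι fᵇ) →
    (α β : Vector M̄.Carrier n) →
    map ι fᵃ ≈ₚ productₚ (λ i → X- (α i)) →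
    map ι fᵇ ≈ₚ productₚ (λ i → X- (β i)) →
    (cs : Permutation′ n → Vector M̄.Carrier n) →
    SolvesVandermonde (rawField M̄) α β cs →
    (j : Fin n) →
    NoMultipleRoot (F-poly (rawField M̄) cs j) →
    (G : Subgroup (SymmetricGroup n) g) →
    Transitive G →
    GroupIsomorphic Gal[ fᵃ ] (subgroupGroup G) →
    GroupIsomorphic Gal[ fᵇ ] (subgroupGroup G) →
    TransitiveOnRoots[ fᵃ ] →
    TransitiveOnRoots[ fᵇ ] →
    AllIndexConjugate (subgroupGroup G) g n →
    (∃[ x ] IsRoot (F-poly (rawField M̄) cs j) (ι x)) ⇔ (Spl[ fᵃ ] ≐ Spl[ fᵇ ])
-- The successor pattern supplies the base point whose stabilisers are compared.
corollary3p9 em (suc n) _ k M M̄ κ _ _ ι closure a b a-simple b-simple α β a-split b-split cs solves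
  j F-simple G _ Gal≅G _ a-transitive b-transitive conjugate =
  mk⇔ (root⇒≐ j F-simple) λ (a⊆b , b⊆a) →
    let τ , equivariant = equivariant-bijection-≅ Gal≅G conjugate
          (α-action a⊆b b⊆a a-transitive b-transitive) (β-action a⊆b b⊆a a-transitive b-transitive)
    in ≐⇒root a⊆b b⊆a a-transitive b-transitive {τ} equivariant j
  where
  open Corollary em M M̄ ι closure (genericPoly (rawField M) a) (genericPoly (rawField M) b)
    a-simple b-simple α β a-split b-split cs solves
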